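{- Let $d\ge 1$ and $\Delta\ge 3$ be integers. If $G$ is a $d$-degenerate graph of maximum degree $\Delta$ and chromatic number $\chi$, then \[\chi'_{\mathrm{inj}}(G)\le \lceil 4ed\log\Delta\rceil\,(2d+1)\,\chi.\]
   Context: All graphs are finite and simple. An injective edge-coloring of a graph $G$ is a function $\psi:E(G)\to\mathbb N$ such that whenever $\psi(e)=\psi(e')$ for distinct edges $e,e'$, no third edge of $G$ joins an endpoint of $e$ to an endpoint of $e'$. The injective chromatic index $\chi'_{\mathrm{inj}}(G)$ is the minimum $k$ such that $G$ has an injective edge-coloring with colors in $\{1,\dots,k\}$. A graph is $d$-degenerate if every subgraph has a vertex of degree at most $d$. $\log$ is the natural logarithm and $e$ is Euler's number. -}

module Defs where

open import Data.Nat as ℕ using (ℕ; zero; suc; _≤_)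
open import Data.Fin using (Fin)
import Data.Fin as F
open import Data.Bool using (Bool; true; false; if_then_else_; _∧_; T)
open import Data.Integer using (+_)
open import Data.Rational as ℚ using (ℚ; 0ℚ; 1ℚ)
open import Data.Product using (Σ; ∃; _×_; _,_)
open import Data.Sum using (_⊎_)
open import Relation.Binary.PropositionalEquality using (_≡_; _≢_)
open import Relation.Nullary using (¬_)

record Graph : Set where
  field
    n      : ℕ
    adj    : Fin n → Fin n → Bool
    sym    : ∀ u v → adj u v ≡ adj v u
    irrefl : ∀ v → adj v v ≡ false
open Graph public

E : (G : Graph) → Fin (n G) → Fin (n G) → Set
E G u v = T (adj G u v)

count : ∀ {m} → (Fin m → Bool) → ℕ
count {zero}  f = 0
count {suc m} f = (if f F.zero then 1 else 0) ℕ.+ count (λ i → f (F.suc i))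

degree : (G : Graph) → Fin (n G) → ℕ
degree G v = count (adj G v)

MaxDegree : Graph → ℕ → Set
MaxDegree G Δ = (∀ v → degree G v ≤ Δ) × (∃ λ v → degree G v ≡ Δ)

record Subgraph (G : Graph) : Set where
  field
    S      : Fin (n G) → Bool
    Fe     : Fin (n G) → Fin (n G) → Bool
    Fsym   : ∀ u v → Fe u v ≡ Fe v u
    Fsub   : ∀ u v → T (Fe u v) → E G u v
    Fends  : ∀ u v → T (Fe u v) → T (S u)
open Subgraph public

subDegree : {G : Graph} → Subgraph G → Fin (n G) → ℕ
subDegree H v = count (λ u → S H u ∧ Fe H v u)

Degenerate : Graph → ℕ → Set
Degenerate G d =
  (H : Subgraph G) → (∃ λ v → T (S H v)) →
  ∃ λ v → T (S H v) × subDegree H v ≤ d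

ProperColoring : (G : Graph) → (k : ℕ) → (Fin (n G) → Fin k) → Set
ProperColoring G k f = ∀ u v → E G u v → f u ≢ f v

Colorable : Graph → ℕ → Set
Colorable G k = Σ (Fin (n G) → Fin k) (ProperColoring G k)

ChromaticNumber : Graph → ℕ → Set
ChromaticNumber G χ = Colorable G χ × (∀ k → Colorable G k → χ ≤ k)

-- Injective edge-colourings.  An edge colouring with colours Fin k is a
-- function c on ordered pairs that is symmetric on edges (values on
-- non-edges are irrelevant).

SameEdge : ∀ {m} → Fin m → Fin m → Fin m → Fin m → Set
SameEdge a b c d = (a ≡ c × b ≡ d) ⊎ (a ≡ d × b ≡ c)

IsInjectiveEdgeColoring : (G : Graph) → (k : ℕ) → (Fin (n G) → Fin (n G) → Fin k) → Set
IsInjectiveEdgeColoring G k c =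
  (∀ u v → E G u v → c u v ≡ c v u) ×
  -- if edges uv and xy are distinct and have the same colour, then any edge
  -- joining an endpoint v of the first to an endpoint x of the second is
  -- one of these two edges (i.e. there is no third such edge).  Since all
  -- orientations of uv and xy are quantified, this covers all endpoint pairs.
  (∀ u v x y → E G u v → E G x y → c u v ≡ c x y → ¬ SameEdge u v x y →
     E G v x → SameEdge v x u v ⊎ SameEdge v x x y)

InjEdgeColorable : Graph → ℕ → Set
InjEdgeColorable G k = Σ (Fin (n G) → Fin (n G) → Fin k) (IsInjectiveEdgeColoring G k)

InjChromaticIndex : Graph → ℕ → Set
InjChromaticIndex G k = InjEdgeColorable G k × (∀ j → InjEdgeColorable G j → k ≤ j)

fromℕ : ℕ → ℚ
fromℕ m = + m ℚ./ 1

expTerm : ℚ → ℕ → ℚ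
expTerm q zero    = 1ℚ
expTerm q (suc k) = expTerm q k ℚ.* q ℚ.* (+ 1 ℚ./ suc k)

expPartial : ℚ → ℕ → ℚ
expPartial q zero    = 0ℚ
expPartial q (suc m) = expPartial q m ℚ.+ expTerm q m

-- "4 e d log Δ ≤ N".  Since e = sup_m expPartial 1 m and
-- log Δ = sup { b ∈ ℚ : b ≥ 0, exp b ≤ Δ } (for Δ ≥ 1), and exp b ≤ Δ iff all
-- partial sums of the exponential series at b are ≤ Δ, this is equivalent to
-- the real inequality.
FourEdLogLe : (d Δ N : ℕ) → Set
FourEdLogLe d Δ N =
  ∀ (m : ℕ) (b : ℚ) → 0ℚ ℚ.≤ b → (∀ j → expPartial b j ℚ.≤ fromℕ Δ) →
  fromℕ (4 ℕ.* d) ℚ.* expPartial 1ℚ m ℚ.* b ℚ.≤ fromℕ N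

-- N = ⌈ 4 e d log Δ ⌉  (least natural number ≥ 4 e d log Δ; the real
-- number is positive under the theorem's hypotheses, so N ≥ 1)
IsCeil4edLog : (d Δ N : ℕ) → Set
IsCeil4edLog d Δ N = FourEdLogLe d Δ N × ¬ FourEdLogLe d Δ (ℕ.pred N)

-- Orient G acyclically with out-degrees at most d′ = min(d, Δ).  Give every vertex M random
-- labels from 3d′ labels.  An edge u → w is bad if in each of the M layers some other
-- out-neighbour of u has the label of w; given all labels but those of w this has probability
-- at most ((d′ - 1) / 3d′)^M, and only d′Δ bad events involve w, so by the local lemma some
-- labelling has no bad edge.  Put u → w into the class given by a layer in which it is good,
-- the label of w there, and the colour of w in a proper χ-colouring.  Within a class a tail has
-- just one head and heads are not adjacent, so two edges u → w and x → y of a class are in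
-- conflict only if one tail is an out-neighbour of the other or of its head.  This relation
-- between tails is acyclic with out-degrees at most 2d, so 2d + 1 colours per class suffice.
-- Finally 3d′M ≤ 4ed log Δ for a suitable M, by exp (K / 200) ≤ (200 / 199)^K.

{-# OPTIONS --safe #-}
module Submission where

open import Defs hiding (sym)
open import Data.Bool using (Bool; true; false; if_then_else_; _∧_; _∨_; not; T)
open import Data.Bool.ListAction using (any)
open import Data.Bool.Properties as Bool using (T-≡; ∧-conicalˡ; ∧-conicalʳ)
open import Data.Fin as Fin using (Fin; combine)
open import Data.Fin.Properties using (_≟_; any?; pigeonhole; combine-injective)
import Data.Integer as ℤ
import Data.Integer.Properties as ℤ
open import Data.List as List using (List; []; _∷_; _++_; length; allFin; tabulate; map; filterᵇ; cartesianProduct; cartesianProductWith)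
import Data.List.Membership.DecPropositional as DecMembership
open import Data.List.Membership.Propositional using (_∈_; _∉_)
open import Data.List.Membership.Propositional.Properties
  using (∈-map⁺; ∈-filter⁺; ∈-filter⁻; ∈-++⁺ˡ; ∈-++⁺ʳ; ∈-++⁻; ∈-allFin; ∈-cartesianProduct⁺)
open import Data.List.Properties using (length-map; length-++; length-tabulate)
open import Data.List.Relation.Unary.All as All using (All; []; _∷_)
open import Data.List.Relation.Unary.Any using (index)
open import Data.List.Relation.Unary.Any.Properties using (lookup-index)
open import Data.Nat hiding (_≟_)
open import Data.Nat.Properties as ℕ hiding (_≟_)
open import Data.Nat.Solver using (module +-*-Solver)
open import Data.Product using (∃; ∃-syntax; _×_; _,_; proj₁; proj₂)
open import Data.Rational as ℚ using (ℚ; 0ℚ; 1ℚ; fromℚᵘ; toℚᵘ; NonNegative; Positive)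
import Data.Rational.Properties as ℚ
open import Data.Rational.Solver using () renaming (module +-*-Solver to ℚ-Solver)
open import Data.Rational.Unnormalised as ℚᵘ using (mkℚᵘ; *≡*; *≤*)
import Data.Rational.Unnormalised.Properties as ℚᵘ
open import Data.Sum using (_⊎_; inj₁; inj₂)
open import Data.Vec using (Vec; []; _∷_; lookup; _[_]≔_)
open import Data.Vec.Properties using (lookup∘update; lookup∘update′)
open import Function using (_∘_; id; Equivalence)
open import Relation.Binary.PropositionalEquality
open import Relation.Nullary using (¬_; Dec; does; yes; no; contradiction; ¬?; _×-dec_; decidable-stable)
open import Relation.Nullary.Decidable using (T?)
open import Algebra.Properties.CommutativeSemigroup +-commutativeSemigroup using (interchange)

private variable
  A A′ A″ : Set

-- Finite sums over lists and indicator functions.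

∑ : List A → (A → ℕ) → ℕ
∑ []       f = 0
∑ (x ∷ xs) f = f x + ∑ xs f

𝟙 : Bool → ℕ
𝟙 b = if b then 1 else 0

∑-mono : ∀ (xs : List A) {f g : A → ℕ} → (∀ x → f x ≤ g x) → ∑ xs f ≤ ∑ xs g
∑-mono []       le = z≤n
∑-mono (x ∷ xs) le = +-mono-≤ (le x) (∑-mono xs le)

∑-cong : ∀ (xs : List A) {f g : A → ℕ} → (∀ x → f x ≡ g x) → ∑ xs f ≡ ∑ xs g
∑-cong []       eq = refl
∑-cong (x ∷ xs) eq = cong₂ _+_ (eq x) (∑-cong xs eq)

∑-+ : ∀ (xs : List A) (f g : A → ℕ) → ∑ xs (λ x → f x + g x) ≡ ∑ xs f + ∑ xs g
∑-+ []       f g = refl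
∑-+ (x ∷ xs) f g = trans (cong (f x + g x +_) (∑-+ xs f g))
  (interchange (f x) (g x) (∑ xs f) (∑ xs g))

∑-*ˡ : ∀ k (xs : List A) (f : A → ℕ) → ∑ xs (λ x → k * f x) ≡ k * ∑ xs f
∑-*ˡ k []       f = sym (*-zeroʳ k)
∑-*ˡ k (x ∷ xs) f = trans (cong (k * f x +_) (∑-*ˡ k xs f)) (sym (*-distribˡ-+ k (f x) _))

∑-const : ∀ (xs : List A) k → ∑ xs (λ _ → k) ≡ length xs * k
∑-const []       k = refl
∑-const (x ∷ xs) k = cong (k +_) (∑-const xs k)

∑-swap : ∀ (xs : List A) (ys : List A′) (f : A → A′ → ℕ) →
         ∑ xs (λ x → ∑ ys (f x)) ≡ ∑ ys (λ y → ∑ xs (λ x → f x y))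
∑-swap []       ys f = sym (trans (∑-const ys 0) (*-zeroʳ (length ys)))
∑-swap (x ∷ xs) ys f = trans (cong (∑ ys (f x) +_) (∑-swap xs ys f)) (sym (∑-+ ys _ _))

∑-++ : ∀ (xs ys : List A) (f : A → ℕ) → ∑ (xs ++ ys) f ≡ ∑ xs f + ∑ ys f
∑-++ []       ys f = refl
∑-++ (x ∷ xs) ys f = trans (cong (f x +_) (∑-++ xs ys f)) (sym (+-assoc (f x) _ _))

∑-map : ∀ (h : A → A′) (xs : List A) (f : A′ → ℕ) → ∑ (List.map h xs) f ≡ ∑ xs (f ∘ h)
∑-map h []       f = refl
∑-map h (x ∷ xs) f = cong (f (h x) +_) (∑-map h xs f)

∑-cartesian : ∀ (h : A → A′ → A″) xs ys (f : A″ → ℕ) →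
              ∑ (cartesianProductWith h xs ys) f ≡ ∑ xs (λ x → ∑ ys (λ y → f (h x y)))
∑-cartesian h []       ys f = refl
∑-cartesian h (x ∷ xs) ys f = trans (∑-++ (List.map (h x) ys) _ f)
  (cong₂ _+_ (∑-map (h x) ys f) (∑-cartesian h xs ys f))

-- The pointwise bound is demanded only for a nonempty list: in the local lemma it comes from an
-- induction that needs some neighbour to drop.
∑-bounded : ∀ (xs : List A) {f : A → ℕ} {k} → (1 ≤ length xs → ∀ x → f x ≤ k) → ∑ xs f ≤ length xs * k
∑-bounded []       le = z≤n
∑-bounded (x ∷ xs) {f} {k} le =
  subst (∑ (x ∷ xs) f ≤_) (∑-const (x ∷ xs) k) (∑-mono (x ∷ xs) (le (s≤s z≤n)))

∑𝟙-witness : ∀ (xs : List A) (b : A → Bool) → 1 ≤ ∑ xs (𝟙 ∘ b) → ∃[ x ] b x ≡ true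
∑𝟙-witness (x ∷ xs) b pos with b x in eq
... | true  = x , eq
... | false = ∑𝟙-witness xs b pos

𝟙-mono : ∀ {a b} → (a ≡ true → b ≡ true) → 𝟙 a ≤ 𝟙 b
𝟙-mono {false} imp = z≤n
𝟙-mono {true}  imp rewrite imp refl = ≤-refl

𝟙-∧ : ∀ a b → 𝟙 (a ∧ b) ≡ 𝟙 a * 𝟙 b
𝟙-∧ false b = refl
𝟙-∧ true  b = sym (+-identityʳ (𝟙 b))

-- Vectors as a finite product space.

vecs : List A → ∀ n → List (Vec A n)
vecs xs zero    = [] ∷ []
vecs xs (suc n) = cartesianProductWith _∷_ xs (vecs xs n)

∑-vecs-suc : ∀ (xs : List A) n (g : Vec A (suc n) → ℕ) →
             ∑ (vecs xs (suc n)) g ≡ ∑ xs (λ a → ∑ (vecs xs n) (λ v → g (a ∷ v)))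
∑-vecs-suc xs n g = ∑-cartesian _∷_ xs (vecs xs n) g

length-as-∑ : ∀ (xs : List A) → length xs ≡ ∑ xs (λ _ → 1)
length-as-∑ xs = sym (trans (∑-const xs 1) (*-identityʳ _))

length-vecs : ∀ (xs : List A) n → length (vecs xs n) ≡ length xs ^ n
length-vecs xs zero    = refl
length-vecs xs (suc n) = begin
  length (vecs xs (suc n))            ≡⟨ length-as-∑ (vecs xs (suc n)) ⟩
  ∑ (vecs xs (suc n)) (λ _ → 1)       ≡⟨ ∑-vecs-suc xs n _ ⟩
  ∑ xs (λ _ → ∑ (vecs xs n) (λ _ → 1)) ≡⟨ ∑-const xs _ ⟩
  length xs * ∑ (vecs xs n) (λ _ → 1) ≡⟨ cong (length xs *_) (length-as-∑ (vecs xs n)) ⟨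
  length xs * length (vecs xs n)      ≡⟨ cong (length xs *_) (length-vecs xs n) ⟩
  length xs ^ suc n                   ∎
  where open ≡-Reasoning

-- Each vector arises from `length xs` pairs of a vector and a new entry at `w`, counted with
-- multiplicity. This is the counting form of conditioning on all coordinates other than `w`.
∑-resample : ∀ (xs : List A) {n} (w : Fin n) (g : Vec A n → ℕ) →
             length xs * ∑ (vecs xs n) g ≡ ∑ (vecs xs n) (λ v → ∑ xs (λ a → g (v [ w ]≔ a)))
∑-resample xs {suc n} Fin.zero g = begin
  length xs * ∑ (vecs xs (suc n)) g
    ≡⟨ cong (length xs *_) (∑-vecs-suc xs n g) ⟩
  length xs * ∑ xs (λ a → ∑ (vecs xs n) (λ v → g (a ∷ v)))
    ≡⟨ cong (length xs *_) (∑-swap xs (vecs xs n) _) ⟩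
  length xs * ∑ (vecs xs n) (λ v → ∑ xs (λ a → g (a ∷ v)))
    ≡⟨ ∑-const xs _ ⟨
  ∑ xs (λ _ → ∑ (vecs xs n) (λ v → ∑ xs (λ a → g (a ∷ v))))
    ≡⟨ ∑-vecs-suc xs n _ ⟨
  ∑ (vecs xs (suc n)) (λ v → ∑ xs (λ a → g (v [ Fin.zero ]≔ a))) ∎
  where open ≡-Reasoning
∑-resample xs {suc n} (Fin.suc w) g = begin
  length xs * ∑ (vecs xs (suc n)) g
    ≡⟨ cong (length xs *_) (∑-vecs-suc xs n g) ⟩
  length xs * ∑ xs (λ a → ∑ (vecs xs n) (λ v → g (a ∷ v)))
    ≡⟨ ∑-*ˡ (length xs) xs _ ⟨
  ∑ xs (λ a → length xs * ∑ (vecs xs n) (λ v → g (a ∷ v)))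
    ≡⟨ ∑-cong xs (λ a → ∑-resample xs w (λ v → g (a ∷ v))) ⟩
  ∑ xs (λ a → ∑ (vecs xs n) (λ v → ∑ xs (λ b → g (a ∷ (v [ w ]≔ b)))))
    ≡⟨ ∑-vecs-suc xs n _ ⟨
  ∑ (vecs xs (suc n)) (λ v → ∑ xs (λ a → g (v [ Fin.suc w ]≔ a))) ∎
  where open ≡-Reasoning

-- The symmetric lopsided local lemma for the uniform measure on a list: every event has
-- probability at most p / C given that events outside its neighbourhood Γ fail, each
-- neighbourhood has at most D events, and 4 D p ≤ C.
module LocalLemma {Ω I : Set} (space : List Ω) (B : I → Ω → Bool) (Γ : I → I → Bool)
  (C p D : ℕ) .{{_ : NonZero C}} .{{_ : NonZero D}} (4Dp≤C : 4 * D * p ≤ C) where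

  open +-*-Solver using (solve; _:+_; _:*_; _:=_; con)

  # : (Ω → Bool) → ℕ
  # g = ∑ space (𝟙 ∘ g)

  avoid : List I → Ω → Bool
  avoid []      ω = true
  avoid (i ∷ S) ω = not (B i ω) ∧ avoid S ω

  -- The events of a list inside and outside the neighbourhood of `i`.
  on off : I → List I → List I
  on  i = filterᵇ (Γ i)
  off i = filterᵇ (not ∘ Γ i)

  private
    off-outside : ∀ i S → All (λ j → Γ i j ≡ false) (off i S)
    off-outside i []      = []
    off-outside i (j ∷ S) with Γ i j in eq
    ... | true  = off-outside i S
    ... | false = eq ∷ off-outside i S

    on+off : ∀ i S → length (on i S) + length (off i S) ≡ length S
    on+off i []      = refl
    on+off i (j ∷ S) with Γ i j
    ... | true  = cong suc (on+off i S)
    ... | false = trans (+-suc _ _) (cong suc (on+off i S))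

    on-off : ∀ j i S → length (on j (off i S)) ≤ length (on j S)
    on-off j i []      = z≤n
    on-off j i (k ∷ S) with Γ i k
    on-off j i (k ∷ S) | true with Γ j k
    ... | true  = m≤n⇒m≤1+n (on-off j i S)
    ... | false = on-off j i S
    on-off j i (k ∷ S) | false with Γ j k
    ... | true  = s≤s (on-off j i S)
    ... | false = on-off j i S

    on-tail : ∀ j i S → length (on j S) ≤ length (on j (i ∷ S))
    on-tail j i S with Γ j i
    ... | true  = n≤1+n _
    ... | false = ≤-refl

    avoid-off : ∀ i S ω → avoid S ω ≡ true → avoid (off i S) ω ≡ true
    avoid-off i []      ω eq = refl
    avoid-off i (j ∷ S) ω eq with Γ i j | B j ω in eqB
    ... | true  | false = avoid-off i S ω eq
    ... | false | false rewrite eqB = avoid-off i S ω eq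

    avoid-join : ∀ i S ω → avoid (on i S) ω ∧ avoid (off i S) ω ≡ true → avoid S ω ≡ true
    avoid-join i []      ω eq = refl
    avoid-join i (j ∷ S) ω eq with Γ i j | B j ω in eqB
    ... | true  | false rewrite eqB = avoid-join i S ω eq
    ... | true  | true  rewrite eqB = eq
    ... | false | false rewrite eqB = avoid-join i S ω eq
    ... | false | true  rewrite eqB with avoid (on i S) ω
    ...   | false = eq
    ...   | true  = eq

    ∧-monoʳ : ∀ a {b c} → (b ≡ true → c ≡ true) → a ∧ b ≡ true → a ∧ c ≡ true
    ∧-monoʳ true imp = imp

    -- A point of `g` either avoids all of `S` or lies in some event of `S`; the first such event
    -- already pays for it.
    union-bound₁ : ∀ (g : Ω → Bool) S ω →
      𝟙 (g ω) ≤ 𝟙 (avoid S ω ∧ g ω) + ∑ S (λ j → 𝟙 (B j ω ∧ g ω))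
    union-bound₁ g []      ω = ≤-reflexive (sym (+-identityʳ _))
    union-bound₁ g (j ∷ S) ω with B j ω
    ... | true  = m≤m+n _ _
    ... | false = union-bound₁ g S ω

    union-bound : ∀ (g : Ω → Bool) S →
      # g ≤ # (λ ω → avoid S ω ∧ g ω) + ∑ S (λ j → # (λ ω → B j ω ∧ g ω))
    union-bound g S = begin
      # g                                                    ≤⟨ ∑-mono space (union-bound₁ g S) ⟩
      ∑ space (λ ω → 𝟙 (avoid S ω ∧ g ω) + ∑ S (λ j → 𝟙 (B j ω ∧ g ω))) ≡⟨ ∑-+ space _ _ ⟩
      # (λ ω → avoid S ω ∧ g ω) + ∑ space (λ ω → ∑ S (λ j → 𝟙 (B j ω ∧ g ω)))
        ≡⟨ cong (# (λ ω → avoid S ω ∧ g ω) +_) (∑-swap space S _) ⟩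
      # (λ ω → avoid S ω ∧ g ω) + ∑ S (λ j → # (λ ω → B j ω ∧ g ω)) ∎
      where open ≤-Reasoning

  -- The bound p / C on the conditional probability of `B i`, with denominators cleared so that
  -- conditioning on an empty event is harmless.
  Conditional : Set
  Conditional = ∀ i S → All (λ j → Γ i j ≡ false) S → C * # (λ ω → B i ω ∧ avoid S ω) ≤ p * # (avoid S)

  Sparse : List I → Set
  Sparse S = ∀ i → length (on i S) ≤ D

  module _ (cond : Conditional) where

    private
      -- The conditional probability of `B i` given `avoid S` is at most 1 / 2D. Dropping the
      -- neighbours of `i` from `S` enlarges the numerator to at most p / C of `avoid (off i S)`,
      -- and by `half` the denominator is at least half of that set. The number `m` only drives the
      -- induction on the length of `S`.
      bound : ∀ m S → length S ≤ m → Sparse S →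
              ∀ i → 2 * D * # (λ ω → B i ω ∧ avoid S ω) ≤ # (avoid S)
      bound m S len sparse i = *-cancelˡ-≤ C (begin
        C * (2 * D * x)      ≡⟨ solve 3 (λ c d x → c :* (con 2 :* d :* x) := con 2 :* d :* (c :* x)) refl C D x ⟩
        2 * D * (C * x)      ≤⟨ *-monoʳ-≤ (2 * D) (*-monoʳ-≤ C (∑-mono space (λ ω → 𝟙-mono (∧-monoʳ (B i ω) (avoid-off i S ω))))) ⟩
        2 * D * (C * # (λ ω → B i ω ∧ avoid (off i S) ω)) ≤⟨ *-monoʳ-≤ (2 * D) (cond i (off i S) (off-outside i S)) ⟩
        2 * D * (p * g)      ≤⟨ *-monoʳ-≤ (2 * D) (*-monoʳ-≤ p half) ⟩
        2 * D * (p * (2 * a)) ≡⟨ solve 3 (λ d p a → con 2 :* d :* (p :* (con 2 :* a)) := con 4 :* d :* p :* a) refl D p a ⟩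
        4 * D * p * a        ≤⟨ *-monoˡ-≤ a 4Dp≤C ⟩
        C * a                ∎)
        where
        open ≤-Reasoning
        x = # (λ ω → B i ω ∧ avoid S ω)
        g = # (avoid (off i S))
        a = # (avoid S)
        y : I → ℕ
        y j = # (λ ω → B j ω ∧ avoid (off i S) ω)
        -- If `i` has a neighbour in `S`, then `off i S` is strictly shorter than `S`, so the
        -- induction applies to it.
        ih : ∀ m → length S ≤ m → 1 ≤ length (on i S) → ∀ j → 2 * D * y j ≤ g
        ih zero    len pos j = contradiction (≤-trans pos (≤-trans (m≤m+n _ _) (≤-trans (≤-reflexive (on+off i S)) len))) λ ()
        ih (suc m) len pos j = bound m (off i S)
          (≤-pred (≤-trans (+-monoˡ-≤ (length (off i S)) pos) (≤-trans (≤-reflexive (on+off i S)) len)))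
          (λ k → ≤-trans (on-off k i S) (sparse k)) j
        -- At most `D` neighbours are put back, each costing at most a fraction 1 / 2D of `g`.
        half : g ≤ 2 * a
        half = *-cancelˡ-≤ D (+-cancelʳ-≤ (D * g) (D * g) (D * (2 * a)) (begin
          D * g + D * g        ≡⟨ solve 2 (λ d g → d :* g :+ d :* g := con 2 :* d :* g) refl D g ⟩
          2 * D * g            ≤⟨ *-monoʳ-≤ (2 * D) (union-bound (avoid (off i S)) (on i S)) ⟩
          2 * D * (# (λ ω → avoid (on i S) ω ∧ avoid (off i S) ω) + ∑ (on i S) y)
            ≤⟨ *-monoʳ-≤ (2 * D) (+-monoˡ-≤ _ (∑-mono space (λ ω → 𝟙-mono (avoid-join i S ω)))) ⟩
          2 * D * (a + ∑ (on i S) y) ≡⟨ *-distribˡ-+ (2 * D) a _ ⟩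
          2 * D * a + 2 * D * ∑ (on i S) y ≡⟨ cong (2 * D * a +_) (∑-*ˡ (2 * D) (on i S) y) ⟨
          2 * D * a + ∑ (on i S) (λ j → 2 * D * y j) ≤⟨ +-monoʳ-≤ (2 * D * a) (∑-bounded (on i S) (ih m len)) ⟩
          2 * D * a + length (on i S) * g ≤⟨ +-monoʳ-≤ (2 * D * a) (*-monoˡ-≤ g (sparse i)) ⟩
          2 * D * a + D * g ≡⟨ cong (_+ D * g) (solve 2 (λ d a → con 2 :* d :* a := d :* (con 2 :* a)) refl D a) ⟩
          D * (2 * a) + D * g  ∎))

      -- By `bound` and D ≥ 1, each further event removes at most half of the points that are left.
      positive : ∀ S → Sparse S → 1 ≤ length space → 1 ≤ # (avoid S)
      positive []      sparse pos = ≤-trans pos (≤-reflexive (length-as-∑ space))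
      positive (i ∷ S) sparse pos = *-cancelˡ-< 2 0 (# (avoid (i ∷ S))) (≤-trans ih (begin
        a                ≤⟨ +-cancelʳ-≤ a a (2 * b) (begin
           a + a           ≡⟨ solve 1 (λ a → a :+ a := con 2 :* a) refl a ⟩
           2 * a           ≤⟨ *-monoʳ-≤ 2 (union-bound (avoid S) (i ∷ [])) ⟩
           2 * (b′ + (x + 0)) ≡⟨ solve 2 (λ b x → con 2 :* (b :+ (x :+ con 0)) := con 2 :* b :+ con 2 :* x) refl b′ x ⟩
           2 * b′ + 2 * x   ≤⟨ +-mono-≤ (*-monoʳ-≤ 2 b′≤b) (≤-trans (*-monoˡ-≤ x (m≤m*n 2 D)) (bound (length S) S ≤-refl sparse′ i)) ⟩
           2 * b + a ∎) ⟩
        2 * b            ∎))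
        where
        open ≤-Reasoning
        sparse′ : Sparse S
        sparse′ j = ≤-trans (on-tail j i S) (sparse j)
        a = # (avoid S)
        b = # (avoid (i ∷ S))
        b′ = # (λ ω → avoid (i ∷ []) ω ∧ avoid S ω)
        x = # (λ ω → B i ω ∧ avoid S ω)
        ih : 1 ≤ a
        ih = positive S sparse′ pos
        b′≤b : b′ ≤ b
        b′≤b = ∑-mono space (λ ω → pw (B i ω) (avoid S ω))
          where
          pw : ∀ u v → 𝟙 ((not u ∧ true) ∧ v) ≤ 𝟙 (not u ∧ v)
          pw true  v = ≤-refl
          pw false v = ≤-refl

    avoidable : ∀ S → Sparse S → 1 ≤ length space → ∃[ ω ] All (λ i → B i ω ≡ false) S
    avoidable S sparse pos with ∑𝟙-witness space (avoid S) (positive S sparse pos)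
    ... | ω , eq = ω , avoids S eq
      where
      avoids : ∀ S → avoid S ω ≡ true → All (λ i → B i ω ≡ false) S
      avoids []      eq = []
      avoids (i ∷ S) eq with B i ω in eqB
      ... | false = eqB ∷ avoids S eq

-- Counting in Fin

count-tabulate : ∀ {n} (g : Fin n → A) (b : A → Bool) → count (b ∘ g) ≡ ∑ (tabulate g) (𝟙 ∘ b)
count-tabulate {n = zero}  g b = refl
count-tabulate {n = suc n} g b = cong (𝟙 (b (g Fin.zero)) +_) (count-tabulate (g ∘ Fin.suc) b)

count≡∑ : ∀ {n} (b : Fin n → Bool) → count b ≡ ∑ (allFin n) (𝟙 ∘ b)
count≡∑ b = count-tabulate id b

count-false : ∀ n → count {n} (λ _ → false) ≡ 0
count-false zero    = refl
count-false (suc n) = count-false n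

count-≟ : ∀ {n} (i : Fin n) → count (λ j → does (i ≟ j)) ≡ 1
count-≟ {suc n} Fin.zero    = cong suc (count-false n)
count-≟ {suc n} (Fin.suc i) = count-≟ i

length-filterᵇ : ∀ (b : A → Bool) xs → length (filterᵇ b xs) ≡ ∑ xs (𝟙 ∘ b)
length-filterᵇ b []       = refl
length-filterᵇ b (x ∷ xs) with b x
... | true  = cong suc (length-filterᵇ b xs)
... | false = length-filterᵇ b xs

𝟙-any : ∀ (b : A → Bool) xs → 𝟙 (any b xs) ≤ ∑ xs (𝟙 ∘ b)
𝟙-any b []       = z≤n
𝟙-any b (x ∷ xs) with b x
... | true  = s≤s z≤n
... | false = 𝟙-any b xs

any-cong : ∀ {b b′ : A → Bool} xs → (∀ x → b x ≡ b′ x) → any b xs ≡ any b′ xs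
any-cong []       eq = refl
any-cong (x ∷ xs) eq = cong₂ _∨_ (eq x) (any-cong xs eq)

any-false : ∀ (b : A → Bool) xs → any b xs ≡ false → All (λ x → b x ≡ false) xs
any-false b []       eq = []
any-false b (x ∷ xs) eq with b x in eqb
... | false = eqb ∷ any-false b xs eq

allᵛ : ∀ {n} → (Fin n → A → Bool) → Vec A n → Bool
allᵛ P []      = true
allᵛ P (a ∷ v) = P Fin.zero a ∧ allᵛ (P ∘ Fin.suc) v

allᵛ-cong : ∀ {n} {P Q : Fin n → A → Bool} v → (∀ j a → P j a ≡ Q j a) → allᵛ P v ≡ allᵛ Q v
allᵛ-cong []      eq = refl
allᵛ-cong (a ∷ v) eq = cong₂ _∧_ (eq Fin.zero a) (allᵛ-cong v (eq ∘ Fin.suc))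

allᵛ-false : ∀ {n} (P : Fin n → A → Bool) v → allᵛ P v ≡ false → ∃[ j ] P j (lookup v j) ≡ false
allᵛ-false P (a ∷ v) eq with P Fin.zero a in eqP
... | false = Fin.zero , eqP
... | true  with allᵛ-false (P ∘ Fin.suc) v eq
...   | j , eqj = Fin.suc j , eqj

-- The coordinates are independent, so the count factors into one sum per coordinate.
∑-allᵛ : ∀ {n} (xs : List A) (P : Fin n → A → Bool) k → (∀ j → ∑ xs (𝟙 ∘ P j) ≤ k) →
         ∑ (vecs xs n) (𝟙 ∘ allᵛ P) ≤ k ^ n
∑-allᵛ {n = zero}  xs P k le = s≤s z≤n
∑-allᵛ {n = suc n} xs P k le = begin
  ∑ (vecs xs (suc n)) (𝟙 ∘ allᵛ P)
    ≡⟨ ∑-vecs-suc xs n _ ⟩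
  ∑ xs (λ a → ∑ (vecs xs n) (λ v → 𝟙 (P Fin.zero a ∧ allᵛ (P ∘ Fin.suc) v)))
    ≡⟨ ∑-cong xs (λ a → trans (∑-cong (vecs xs n) (λ v → 𝟙-∧ (P Fin.zero a) _)) (∑-*ˡ (𝟙 (P Fin.zero a)) (vecs xs n) _)) ⟩
  ∑ xs (λ a → 𝟙 (P Fin.zero a) * s)
    ≡⟨ ∑-cong xs (λ a → *-comm (𝟙 (P Fin.zero a)) s) ⟩
  ∑ xs (λ a → s * 𝟙 (P Fin.zero a))
    ≡⟨ ∑-*ˡ s xs _ ⟩
  s * ∑ xs (𝟙 ∘ P Fin.zero)
    ≤⟨ *-mono-≤ (∑-allᵛ xs (P ∘ Fin.suc) k (le ∘ Fin.suc)) (le Fin.zero) ⟩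
  k ^ n * k
    ≡⟨ *-comm (k ^ n) k ⟩
  k ^ suc n ∎
  where
  open ≤-Reasoning
  s = ∑ (vecs xs n) (𝟙 ∘ allᵛ (P ∘ Fin.suc))

∧-congʳ : ∀ a {b c} → (a ≡ true → b ≡ c) → a ∧ b ≡ a ∧ c
∧-congʳ false eq = refl
∧-congʳ true  eq = eq refl

-- Separating labels from the local lemma.

module Labelling {n : ℕ} (out : Fin n → Fin n → Bool) (e Δ c M : ℕ)
  .{{_ : NonZero c}} .{{_ : NonZero Δ}}
  (outdegree : ∀ u → count (out u) ≤ suc e) (indegree : ∀ w → count (λ u → out u w) ≤ Δ)
  (few : 4 * (suc e * Δ) * e ^ M ≤ c ^ M) where

  sibling : (u w w′ : Fin n) → Bool
  sibling u w w′ = out u w′ ∧ not (does (w ≟ w′))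

  Label : Set
  Label = Vec (Fin c) M

  labels : List Label
  labels = vecs (allFin c) M

  -- A sibling of `w` under `u` has label `a` in layer `j`. The label of `w` itself does not enter,
  -- which makes it free to be resampled.
  hit : (u w : Fin n) → Vec Label n → Fin M → Fin c → Bool
  hit u w ω j a = any (λ w′ → sibling u w w′ ∧ does (lookup (lookup ω w′) j ≟ a)) (allFin n)

  -- Every ordered pair indexes an event; for a pair that is no arc the event is empty.
  bad : Fin n × Fin n → Vec Label n → Bool
  bad (u , w) ω = out u w ∧ allᵛ (hit u w ω) (lookup ω w)

  -- The arcs whose tail has `w` as an out-neighbour: only their events can change with the label of
  -- `w`. The relation need not be symmetric.
  Γ : Fin n × Fin n → Fin n × Fin n → Bool
  Γ (u , w) (u′ , w′) = out u′ w ∧ out u′ w′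

  -- The head `w` accounts for one of the at most `suc e` out-neighbours.
  sibling-count : ∀ u w → out u w ≡ true → ∑ (allFin n) (𝟙 ∘ sibling u w) ≤ e
  sibling-count u w uw = +-cancelˡ-≤ 1 _ _ (begin
    1 + ∑ (allFin n) (𝟙 ∘ sibling u w)
      ≡⟨ cong (_+ ∑ (allFin n) (𝟙 ∘ sibling u w)) (trans (sym (count-≟ w)) (count≡∑ (λ w′ → does (w ≟ w′)))) ⟩
    ∑ (allFin n) (λ w′ → 𝟙 (does (w ≟ w′))) + ∑ (allFin n) (𝟙 ∘ sibling u w)
      ≡⟨ ∑-+ (allFin n) _ _ ⟨
    ∑ (allFin n) (λ w′ → 𝟙 (does (w ≟ w′)) + 𝟙 (sibling u w w′))
      ≡⟨ ∑-cong (allFin n) split ⟩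
    ∑ (allFin n) (𝟙 ∘ out u)
      ≡⟨ count≡∑ (out u) ⟨
    count (out u)
      ≤⟨ outdegree u ⟩
    1 + e ∎)
    where
    open ≤-Reasoning
    split : ∀ w′ → 𝟙 (does (w ≟ w′)) + 𝟙 (sibling u w w′) ≡ 𝟙 (out u w′)
    split w′ with w ≟ w′
    ... | yes refl rewrite uw = refl
    ... | no  _ with out u w′
    ...   | true  = refl
    ...   | false = refl

  -- Exchanging the sums, each sibling blocks exactly one label in layer `j`.
  hit-count : ∀ u w ω j → out u w ≡ true → ∑ (allFin c) (𝟙 ∘ hit u w ω j) ≤ e
  hit-count u w ω j uw = begin
    ∑ (allFin c) (𝟙 ∘ hit u w ω j)
      ≤⟨ ∑-mono (allFin c) (λ a → 𝟙-any _ (allFin n)) ⟩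
    ∑ (allFin c) (λ a → ∑ (allFin n) (λ w′ → 𝟙 (sibling u w w′ ∧ does (x w′ ≟ a))))
      ≡⟨ ∑-swap (allFin c) (allFin n) _ ⟩
    ∑ (allFin n) (λ w′ → ∑ (allFin c) (λ a → 𝟙 (sibling u w w′ ∧ does (x w′ ≟ a))))
      ≡⟨ ∑-cong (allFin n) (λ w′ → trans (∑-cong (allFin c) (λ a → 𝟙-∧ (sibling u w w′) _)) (∑-*ˡ (𝟙 (sibling u w w′)) (allFin c) _)) ⟩
    ∑ (allFin n) (λ w′ → 𝟙 (sibling u w w′) * ∑ (allFin c) (λ a → 𝟙 (does (x w′ ≟ a))))
      ≡⟨ ∑-cong (allFin n) (λ w′ → trans (cong (𝟙 (sibling u w w′) *_) (trans (sym (count≡∑ (λ a → does (x w′ ≟ a)))) (count-≟ (x w′)))) (*-identityʳ _)) ⟩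
    ∑ (allFin n) (𝟙 ∘ sibling u w)
      ≤⟨ sibling-count u w uw ⟩
    e ∎
    where
    open ≤-Reasoning
    x : Fin n → Fin c
    x w′ = lookup (lookup ω w′) j

  hit-resample : ∀ u w ω v a → (∀ w′ → sibling u w w′ ≡ true → w′ ≢ v) →
                 ∀ j b → hit u w (ω [ v ]≔ a) j b ≡ hit u w ω j b
  hit-resample u w ω v a avoid j b = any-cong (allFin n) (λ w′ → ∧-congʳ (sibling u w w′) (λ sib →
    cong (λ y → does (lookup y j ≟ b)) (lookup∘update′ (avoid w′ sib) ω a)))

  sibling-≢ : ∀ u w w′ → sibling u w w′ ≡ true → w′ ≢ w
  sibling-≢ u w .w eq refl with out u w | w ≟ w
  ... | true | no w≢w = w≢w refl

  sibling-out : ∀ u w w′ → sibling u w w′ ≡ true → out u w′ ≡ true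
  sibling-out u w w′ eq with out u w′
  ... | true = refl

  bad-resample : ∀ u w ω v a → Γ (u , v) (u , w) ≡ false → bad (u , w) (ω [ v ]≔ a) ≡ bad (u , w) ω
  bad-resample u w ω v a eq = ∧-congʳ (out u w) λ uw → trans
      (cong (allᵛ (hit u w (ω [ v ]≔ a))) (lookup∘update′ (other uw w uw) ω a))
      (allᵛ-cong (lookup ω w) (hit-resample u w ω v a (λ w′ sib → other uw w′ (sibling-out u w w′ sib))))
    where
    other : out u w ≡ true → ∀ w′ → out u w′ ≡ true → w′ ≢ v
    other uw w′ uw′ refl = contradiction (trans (sym (cong₂ _∧_ uw′ uw)) eq) λ ()

  instance
    c^M≢0 : NonZero (c ^ M)
    c^M≢0 = m^n≢0 c M
    D≢0 : NonZero (suc e * Δ)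
    D≢0 = m*n≢0 (suc e) Δ

  -- Of the `c ^ M` labels of a head at most `e ^ M` make its arc bad, and `suc e * Δ` bounds the
  -- neighbourhoods.
  open LocalLemma (vecs labels n) bad Γ (c ^ M) (e ^ M) (suc e * Δ) few

  length-labels : length labels ≡ c ^ M
  length-labels = trans (length-vecs (allFin c) M) (cong (_^ M) (length-tabulate {n = c} id))

  avoid-resample : ∀ u w ω a S → All (λ i → Γ (u , w) i ≡ false) S → avoid S (ω [ w ]≔ a) ≡ avoid S ω
  avoid-resample u w ω a []              []         = refl
  avoid-resample u w ω a ((u′ , w′) ∷ S) (eq ∷ eqs) =
    -- `Γ` ignores the tail of its first argument, so `eq` also has the form with `u′` in place of
    -- `u`.
    cong₂ _∧_ (cong not (bad-resample u′ w′ ω w a eq)) (avoid-resample u w ω a S eqs)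

  -- Resample the label of `w` with all other labels fixed: `avoid S` does not change, and at most
  -- `e ^ M` choices make the arc bad.
  conditional : Conditional
  conditional (u , w) S outside = begin
    c ^ M * # (λ ω → bad (u , w) ω ∧ avoid S ω)
      ≡⟨ cong (_* # (λ ω → bad (u , w) ω ∧ avoid S ω)) length-labels ⟨
    length labels * # (λ ω → bad (u , w) ω ∧ avoid S ω)
      ≡⟨ ∑-resample labels w _ ⟩
    ∑ (vecs labels n) (λ ω → ∑ labels (λ a → 𝟙 (bad (u , w) (ω [ w ]≔ a) ∧ avoid S (ω [ w ]≔ a))))
      ≤⟨ ∑-mono (vecs labels n) pointwise ⟩
    ∑ (vecs labels n) (λ ω → e ^ M * 𝟙 (avoid S ω))
      ≡⟨ ∑-*ˡ (e ^ M) (vecs labels n) _ ⟩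
    e ^ M * # (avoid S) ∎
    where
    open ≤-Reasoning
    bad-update : ∀ ω a → bad (u , w) (ω [ w ]≔ a) ≡ out u w ∧ allᵛ (hit u w ω) a
    bad-update ω a = ∧-congʳ (out u w) λ uw → trans
      (cong (allᵛ (hit u w (ω [ w ]≔ a))) (lookup∘update w ω a))
      (allᵛ-cong a (hit-resample u w ω w a (sibling-≢ u w)))
    rare : ∀ ω → ∑ labels (λ a → 𝟙 (out u w ∧ allᵛ (hit u w ω) a)) ≤ e ^ M
    rare ω with out u w in uw
    ... | true  = ∑-allᵛ (allFin c) (hit u w ω) e (λ j → hit-count u w ω j uw)
    ... | false = ≤-trans (≤-reflexive (trans (∑-const labels 0) (*-zeroʳ (length labels)))) z≤n
    pointwise : ∀ ω → ∑ labels (λ a → 𝟙 (bad (u , w) (ω [ w ]≔ a) ∧ avoid S (ω [ w ]≔ a))) ≤ e ^ M * 𝟙 (avoid S ω)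
    pointwise ω = begin
      ∑ labels (λ a → 𝟙 (bad (u , w) (ω [ w ]≔ a) ∧ avoid S (ω [ w ]≔ a)))
        ≡⟨ ∑-cong labels (λ a → trans (cong 𝟙 (cong₂ _∧_ (bad-update ω a) (avoid-resample u w ω a S outside)))
             (trans (𝟙-∧ (out u w ∧ allᵛ (hit u w ω) a) (avoid S ω)) (*-comm _ (𝟙 (avoid S ω))))) ⟩
      ∑ labels (λ a → 𝟙 (avoid S ω) * 𝟙 (out u w ∧ allᵛ (hit u w ω) a))
        ≡⟨ ∑-*ˡ (𝟙 (avoid S ω)) labels _ ⟩
      𝟙 (avoid S ω) * ∑ labels (λ a → 𝟙 (out u w ∧ allᵛ (hit u w ω) a))
        ≤⟨ *-monoʳ-≤ (𝟙 (avoid S ω)) (rare ω) ⟩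
      𝟙 (avoid S ω) * e ^ M
        ≡⟨ *-comm (𝟙 (avoid S ω)) (e ^ M) ⟩
      e ^ M * 𝟙 (avoid S ω) ∎

  pairs : List (Fin n × Fin n)
  pairs = cartesianProduct (allFin n) (allFin n)

  -- A neighbour is given by one of the at most `Δ` in-neighbours of `w` and one of the at most
  -- `suc e` heads of that in-neighbour.
  sparse : Sparse pairs
  sparse (u , w) = begin
    length (on (u , w) pairs)
      ≡⟨ length-filterᵇ (Γ (u , w)) pairs ⟩
    ∑ pairs (𝟙 ∘ Γ (u , w))
      ≡⟨ ∑-cartesian _,_ (allFin n) (allFin n) _ ⟩
    ∑ (allFin n) (λ u′ → ∑ (allFin n) (λ w′ → 𝟙 (out u′ w ∧ out u′ w′)))
      ≡⟨ ∑-cong (allFin n) (λ u′ → trans (∑-cong (allFin n) (λ w′ → 𝟙-∧ (out u′ w) _)) (∑-*ˡ (𝟙 (out u′ w)) (allFin n) _)) ⟩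
    ∑ (allFin n) (λ u′ → 𝟙 (out u′ w) * ∑ (allFin n) (𝟙 ∘ out u′))
      ≤⟨ ∑-mono (allFin n) (λ u′ → *-monoʳ-≤ (𝟙 (out u′ w)) (≤-trans (≤-reflexive (sym (count≡∑ (out u′)))) (outdegree u′))) ⟩
    ∑ (allFin n) (λ u′ → 𝟙 (out u′ w) * suc e)
      ≡⟨ ∑-cong (allFin n) (λ u′ → *-comm (𝟙 (out u′ w)) (suc e)) ⟩
    ∑ (allFin n) (λ u′ → suc e * 𝟙 (out u′ w))
      ≡⟨ ∑-*ˡ (suc e) (allFin n) _ ⟩
    suc e * ∑ (allFin n) (λ u′ → 𝟙 (out u′ w))
      ≡⟨ cong (suc e *_) (count≡∑ (λ u′ → out u′ w)) ⟨
    suc e * count (λ u′ → out u′ w)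
      ≤⟨ *-monoʳ-≤ (suc e) (indegree w) ⟩
    suc e * Δ ∎
    where open ≤-Reasoning

  space-inhabited : 1 ≤ length (vecs labels n)
  space-inhabited = ≤-trans (m^n>0 (c ^ M) n)
    (≤-reflexive (sym (trans (length-vecs labels n) (cong (_^ n) length-labels))))

  separating-labels : ∃[ f ] ∀ u w → out u w ≡ true →
    ∃[ j ] ∀ w′ → out u w′ ≡ true → f w′ j ≡ f w j → w ≡ w′
  separating-labels with avoidable conditional pairs sparse space-inhabited
  ... | ω , none = f , good
    where
    f : Fin n → Fin M → Fin c
    f w j = lookup (lookup ω w) j
    good : ∀ u w → out u w ≡ true → ∃[ j ] ∀ w′ → out u w′ ≡ true → f w′ j ≡ f w j → w ≡ w′
    good u w uw = proj₁ miss , λ w′ uw′ same → separated w′ uw′ same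
      where
      clear : allᵛ (hit u w ω) (lookup ω w) ≡ false
      clear = subst (λ b → b ∧ allᵛ (hit u w ω) (lookup ω w) ≡ false) uw
        (All.lookup none (∈-cartesianProduct⁺ (∈-allFin u) (∈-allFin w)))
      miss : ∃[ j ] hit u w ω j (f w j) ≡ false
      miss = allᵛ-false (hit u w ω) (lookup ω w) clear
      separated : ∀ w′ → out u w′ ≡ true → f w′ (proj₁ miss) ≡ f w (proj₁ miss) → w ≡ w′
      separated w′ uw′ same with w ≟ w′ | All.lookup (any-false _ (allFin n) (proj₂ miss)) (∈-allFin w′)
      ... | yes w≡w′ | _ = w≡w′
      ... | no  _    | eq rewrite uw′ with f w′ (proj₁ miss) ≟ f w (proj₁ miss)
      ...   | no differ = contradiction same differ

-- Boolean truth and counts of subsets.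

T⇒≡ : ∀ {b} → T b → b ≡ true
T⇒≡ = Equivalence.to T-≡

≡⇒T : ∀ {b} → b ≡ true → T b
≡⇒T = Equivalence.from T-≡

count-mono : ∀ {n} {b b′ : Fin n → Bool} → (∀ i → b i ≡ true → b′ i ≡ true) → count b ≤ count b′
count-mono {b = b} {b′} imp = subst₂ _≤_ (sym (count≡∑ b)) (sym (count≡∑ b′))
  (∑-mono (allFin _) (λ i → 𝟙-mono (imp i)))

count-remove : ∀ {n} (b : Fin n → Bool) v → b v ≡ true → count b ≡ suc (count (λ u → b u ∧ not (does (v ≟ u))))
count-remove {n} b v bv = begin
  count b
    ≡⟨ count≡∑ b ⟩
  ∑ (allFin n) (𝟙 ∘ b)
    ≡⟨ ∑-cong (allFin n) split ⟨
  ∑ (allFin n) (λ u → 𝟙 (does (v ≟ u)) + 𝟙 (b u ∧ not (does (v ≟ u))))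
    ≡⟨ ∑-+ (allFin n) _ _ ⟩
  ∑ (allFin n) (λ u → 𝟙 (does (v ≟ u))) + ∑ (allFin n) (λ u → 𝟙 (b u ∧ not (does (v ≟ u))))
    ≡⟨ cong₂ _+_ (count≡∑ (λ u → does (v ≟ u))) (count≡∑ (λ u → b u ∧ not (does (v ≟ u)))) ⟨
  count (λ u → does (v ≟ u)) + count (λ u → b u ∧ not (does (v ≟ u)))
    ≡⟨ cong (_+ count (λ u → b u ∧ not (does (v ≟ u)))) (count-≟ v) ⟩
  suc (count (λ u → b u ∧ not (does (v ≟ u)))) ∎
  where
  open ≡-Reasoning
  split : ∀ u → 𝟙 (does (v ≟ u)) + 𝟙 (b u ∧ not (does (v ≟ u))) ≡ 𝟙 (b u)
  split u with v ≟ u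
  ... | yes refl rewrite bv = refl
  ... | no  _ with b u
  ...   | true  = refl
  ...   | false = refl

count-witness : ∀ {n} (b : Fin n → Bool) → 1 ≤ count b → ∃[ v ] b v ≡ true
count-witness b pos = ∑𝟙-witness (allFin _) b (≤-trans pos (≤-reflexive (count≡∑ b)))

-- Acyclic orientations

record Orientation (G : Graph) (d : ℕ) : Set where
  field
    out        : Fin (n G) → Fin (n G) → Bool
    rank       : Fin (n G) → ℕ
    size       : ℕ
    bounded    : ∀ u → rank u < size
    descending : ∀ {u w} → out u w ≡ true → rank w < rank u
    out⇒adj    : ∀ {u w} → out u w ≡ true → adj G u w ≡ true
    oriented   : ∀ {u w} → adj G u w ≡ true → out u w ≡ true ⊎ out w u ≡ true
    outdegree  : ∀ u → count (out u) ≤ d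

module Peeling (G : Graph) (d : ℕ) (degenerate : Degenerate G d) where

  V : Set
  V = Fin (n G)

  induced : (V → Bool) → Subgraph G
  induced S = record
    { S     = S
    ; Fe    = λ u w → (S u ∧ S w) ∧ adj G u w
    ; Fsym  = λ u w → cong₂ _∧_ (Bool.∧-comm (S u) (S w)) (Graph.sym G u w)
    ; Fsub  = λ u w e → ≡⇒T (∧-conicalʳ (S u ∧ S w) _ (T⇒≡ e))
    ; Fends = λ u w e → ≡⇒T (∧-conicalˡ (S u) (S w) (∧-conicalˡ (S u ∧ S w) _ (T⇒≡ e)))
    }

  lower : (V → Bool) → (V → ℕ) → V → V → Bool
  lower S r u w = (S w ∧ adj G u w) ∧ (r w <ᵇ r u)

  record Ranking (S : V → Bool) (m : ℕ) : Set where
    field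
      r         : V → ℕ
      bounded   : ∀ u → S u ≡ true → r u < m
      distinct  : ∀ u w → S u ≡ true → S w ≡ true → adj G u w ≡ true → r u ≢ r w
      outdegree : ∀ u → S u ≡ true → count (lower S r u) ≤ d

  -- Degeneracy yields a vertex with at most `d` neighbours inside `S`. It receives the top rank,
  -- and the remaining vertices are ranked below it by induction.
  peel : ∀ m S → count S ≡ m → Ranking S m
  peel zero S empty = record
    { r         = λ _ → 0
    ; bounded   = λ u Su → contradiction Su (none u)
    ; distinct  = λ u _ Su → contradiction Su (none u)
    ; outdegree = λ u Su → contradiction Su (none u)
    }
    where
    none : ∀ u → S u ≢ true
    none u Su with () ← trans (sym empty) (count-remove S u Su)
  peel (suc m) S eq = extend (degenerate (induced S) (proj₁ first , ≡⇒T (proj₂ first)))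
    where
    first : ∃[ v ] S v ≡ true
    first = count-witness S (subst (1 ≤_) (sym eq) (s≤s z≤n))
    extend : (∃[ v ] T (S v) × subDegree (induced S) v ≤ d) → Ranking S (suc m)
    extend (v , TSv , deg) = record
      { r = r′ ; bounded = bounded′ ; distinct = distinct′ ; outdegree = outdegree′ }
      where
      Sv : S v ≡ true
      Sv = T⇒≡ TSv
      S′ : V → Bool
      S′ u = S u ∧ not (does (v ≟ u))
      open Ranking (peel m S′ (suc-injective (trans (sym (count-remove S v Sv)) eq)))
      r′ : V → ℕ
      r′ u = if does (v ≟ u) then m else r u
      S′-intro : ∀ u → S u ≡ true → v ≢ u → S′ u ≡ true
      S′-intro u Su v≢u with v ≟ u
      ... | yes v≡u = contradiction v≡u v≢u
      ... | no  _   rewrite Su = refl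
      r′-v : r′ v ≡ m
      r′-v with v ≟ v
      ... | yes _  = refl
      ... | no v≢v = contradiction refl v≢v
      r′-other : ∀ u → v ≢ u → r′ u ≡ r u
      r′-other u v≢u with v ≟ u
      ... | yes v≡u = contradiction v≡u v≢u
      ... | no  _   = refl
      bounded′ : ∀ u → S u ≡ true → r′ u < suc m
      bounded′ u Su with v ≟ u
      ... | yes _   = ℕ.n<1+n m
      ... | no  v≢u = m<n⇒m<1+n (bounded u (S′-intro u Su v≢u))
      below : ∀ u → S u ≡ true → v ≢ u → r′ u < m
      below u Su v≢u = subst (_< m) (sym (r′-other u v≢u)) (bounded u (S′-intro u Su v≢u))
      distinct′ : ∀ u w → S u ≡ true → S w ≡ true → adj G u w ≡ true → r′ u ≢ r′ w
      distinct′ u w Su Sw uw = case (v ≟ u) (v ≟ w)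
        where
        case : Dec (v ≡ u) → Dec (v ≡ w) → r′ u ≢ r′ w
        case (yes refl) (yes refl) = contradiction (trans (sym uw) (irrefl G v)) λ ()
        case (yes refl) (no v≢w)   eq′ = <⇒≢ (below w Sw v≢w) (trans (sym eq′) r′-v)
        case (no v≢u)   (yes refl) eq′ = <⇒≢ (below u Su v≢u) (trans eq′ r′-v)
        case (no v≢u)   (no v≢w)   eq′ = distinct u w (S′-intro u Su v≢u) (S′-intro w Sw v≢w) uw
          (trans (sym (r′-other u v≢u)) (trans eq′ (r′-other w v≢w)))
      outdegree′ : ∀ u → S u ≡ true → count (lower S r′ u) ≤ d
      outdegree′ u Su = case (v ≟ u)
        where
        case : Dec (v ≡ u) → count (lower S r′ u) ≤ d
        -- The lower neighbours of `v` lie in `S`, so its degree in the induced subgraph bounds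
        -- their number.
        case (yes refl) = ≤-trans (count-mono (λ w low → trans
            (cong₂ _∧_ (Sw w low) (cong₂ _∧_ (cong₂ _∧_ Sv (Sw w low)) (∧-conicalʳ (S w) _ (∧-conicalˡ _ _ low)))) refl)) deg
          where
          Sw : ∀ w → lower S r′ v w ≡ true → S w ≡ true
          Sw w low = ∧-conicalˡ (S w) _ (∧-conicalˡ _ _ low)
        -- Being on top, `v` is no lower neighbour of `u`, so deleting `v` loses nothing from this
        -- count.
        case (no v≢u) = ≤-trans (count-mono still-lower) (outdegree u (S′-intro u Su v≢u))
          where
          still-lower : ∀ w → lower S r′ u w ≡ true → lower S′ r u w ≡ true
          still-lower w low = cong₂ _∧_
              (cong₂ _∧_ (S′-intro w (∧-conicalˡ (S w) _ (∧-conicalˡ _ _ low)) v≢w) (∧-conicalʳ (S w) _ (∧-conicalˡ _ _ low)))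
              (subst₂ (λ a b → (a <ᵇ b) ≡ true) (r′-other w v≢w) (r′-other u v≢u) (∧-conicalʳ (S w ∧ adj G u w) _ low))
            where
            r′w<r′u : r′ w < r′ u
            r′w<r′u = <ᵇ⇒< _ _ (≡⇒T (∧-conicalʳ (S w ∧ adj G u w) _ low))
            v≢w : v ≢ w
            v≢w refl = <-asym (below u Su v≢u) (subst (_< r′ u) r′-v r′w<r′u)

  orientation : Orientation G d
  orientation = record
    { out        = λ u w → lower full r u w
    ; rank       = r
    ; size       = count full
    ; bounded    = λ u → bounded u refl
    ; descending = λ {u} {w} uw → <ᵇ⇒< _ _ (≡⇒T (∧-conicalʳ (adj G u w) _ uw))
    ; out⇒adj    = λ {u} {w} uw → ∧-conicalˡ (adj G u w) _ uw
    ; oriented   = choose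
    ; outdegree  = λ u → outdegree u refl
    }
    where
    full : V → Bool
    full _ = true
    open Ranking (peel (count full) full refl)
    choose : ∀ {u w} → adj G u w ≡ true → lower full r u w ≡ true ⊎ lower full r w u ≡ true
    choose {u} {w} uw with ≤-total (r u) (r w)
    ... | inj₁ le = inj₂ (cong₂ _∧_ (trans (Graph.sym G w u) uw) (T⇒≡ (<⇒<ᵇ (≤∧≢⇒< le (distinct u w refl refl uw)))))
    ... | inj₂ ge = inj₁ (cong₂ _∧_ uw (T⇒≡ (<⇒<ᵇ (≤∧≢⇒< ge (distinct u w refl refl uw ∘ sym)))))

-- Greedy colouring

-- If every colour occurred, mapping it to a position in `xs` would put two different colours at one
-- position.
fresh : ∀ {K} (xs : List (Fin K)) → length xs < K → ∃[ a ] a ∉ xs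
fresh {K} xs short with any? (λ a → ¬? (a ∈? xs))
  where open DecMembership (_≟_ {K}) using (_∈?_)
... | yes found = found
... | no  none  = contradiction (cong Fin.toℕ same) (<⇒≢ i<j)
  where
  open DecMembership (_≟_ {K}) using (_∈?_)
  occurs : ∀ a → a ∈ xs
  occurs a = decidable-stable (a ∈? xs) (λ a∉ → none (a , a∉))
  clash = pigeonhole short (index ∘ occurs)
  i = proj₁ clash
  j = proj₁ (proj₂ clash)
  i<j = proj₁ (proj₂ (proj₂ clash))
  same : i ≡ j
  same = trans (lookup-index (occurs i))
    (trans (cong (List.lookup xs) (proj₂ (proj₂ (proj₂ clash)))) (sym (lookup-index (occurs j))))

module Greedy {n K : ℕ} (nbr : Fin n → List (Fin n)) (rank : Fin n → ℕ)
  (descending : ∀ u {x} → x ∈ nbr u → rank x < rank u) (short : ∀ u → length (nbr u) < K) where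

  -- Round `m` recolours exactly the vertices of rank `m`. Their listed neighbours have smaller rank
  -- and keep their colours, as do all vertices in earlier constraints.
  greedy : ∀ m → ∃[ t ] ((u : Fin n) → rank u < m → ∀ {x} → x ∈ nbr u → t x ≢ t u)
  -- The initial colour is arbitrary; one exists because `short u` forces `K` to be positive.
  greedy zero    = (λ u → proj₁ (fresh {K} [] (≤-<-trans z≤n (short u)))) , λ _ ()
  greedy (suc m) with greedy m
  ... | t , proper = t′ , proper′
    where
    choice : ∀ u → ∃[ a ] a ∉ map t (nbr u)
    choice u = fresh (map t (nbr u)) (subst (_< K) (sym (length-map t (nbr u))) (short u))
    t′ : Fin n → Fin K
    t′ u with rank u ℕ.≟ m
    ... | yes _ = proj₁ (choice u)
    ... | no  _ = t u
    unchanged : ∀ x → rank x ≢ m → t′ x ≡ t x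
    unchanged x ≢m with rank x ℕ.≟ m
    ... | yes ≡m = contradiction ≡m ≢m
    ... | no  _  = refl
    proper′ : ∀ u → rank u < suc m → ∀ {x} → x ∈ nbr u → t′ x ≢ t′ u
    proper′ u u<1+m {x} x∈ eq with rank u ℕ.≟ m
    ... | yes u≡m = proj₂ (choice u) (subst (_∈ map t (nbr u))
      (trans (sym (unchanged x (<⇒≢ (subst (rank x <_) u≡m (descending u x∈))))) eq) (∈-map⁺ t x∈))
    ... | no  u≢m = proper u u<m x∈ (trans (sym (unchanged x (<⇒≢ (<-trans (descending u x∈) u<m)))) eq)
      where
      u<m : rank u < m
      u<m = ≤∧≢⇒< (≤-pred u<1+m) u≢m

-- Injective colourings from separating labels

module Colouring (G : Graph) {d : ℕ} (orientation : Orientation G d) {χ : ℕ} (φ : Fin (n G) → Fin χ)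
  (proper : ProperColoring G χ φ) {M c : ℕ} (f : Fin (n G) → Fin (suc M) → Fin c)
  (separating : ∀ u w → Orientation.out orientation u w ≡ true →
     ∃[ j ] ∀ w′ → Orientation.out orientation u w′ ≡ true → f w′ j ≡ f w j → w ≡ w′) where

  open Orientation orientation

  V : Set
  V = Fin (n G)

  Class : Set
  Class = Fin (suc M * c * χ)

  separated : ∀ u w → ∃[ j ] (out u w ≡ true → ∀ w′ → out u w′ ≡ true → f w′ j ≡ f w j → w ≡ w′)
  separated u w with out u w Bool.≟ true
  ... | yes uw = proj₁ (separating u w uw) , λ _ → proj₂ (separating u w uw)
  -- Pairs that are not arcs get a default layer, available since there are `suc M` layers.
  ... | no ¬uw = Fin.zero , λ uw → contradiction uw ¬uw

  layer : V → V → Fin (suc M)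
  layer u w = proj₁ (separated u w)

  κ : V → V → Class
  κ u w = combine (combine (layer u w) (f w (layer u w))) (φ w)

  -- Equal classes give the same layer and the same label there, and that layer is good for the arc
  -- from `u` to `w`. Hence a tail has at most one head in each class.
  κ-separates : ∀ {u w x y} → κ u w ≡ κ x y → out u w ≡ true → out u y ≡ true → w ≡ y
  κ-separates {u} {w} {x} {y} eq uw uy = proj₂ (separated u w) uw y uy
      (trans (cong (f y) (proj₁ same)) (sym (proj₂ same)))
    where
    same : layer u w ≡ layer x y × f w (layer u w) ≡ f y (layer x y)
    same = combine-injective _ _ _ _ (proj₁ (combine-injective {m = suc M * c} _ _ _ _ eq))

  κ-heads : ∀ {u w x y} → κ u w ≡ κ x y → adj G w y ≢ true
  κ-heads {u} {w} {x} {y} eq wy = proper w y (≡⇒T wy) (proj₂ (combine-injective {m = suc M * c} _ _ _ _ eq))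

  outs : V → List V
  outs u = filterᵇ (out u) (allFin (n G))

  ∈-outs⁺ : ∀ {u w} → out u w ≡ true → w ∈ outs u
  ∈-outs⁺ {u} {w} uw = ∈-filter⁺ (T? ∘ out u) (∈-allFin w) (≡⇒T uw)

  ∈-outs⁻ : ∀ {u w} → w ∈ outs u → out u w ≡ true
  ∈-outs⁻ {u} w∈ = T⇒≡ (proj₂ (∈-filter⁻ (T? ∘ out u) {xs = allFin (n G)} w∈))

  length-outs : ∀ u → length (outs u) ≤ d
  length-outs u = ≤-trans (≤-reflexive (trans (length-filterᵇ (out u) (allFin (n G))) (sym (count≡∑ (out u))))) (outdegree u)

  Head : Class → V → V → Set
  Head k u w = out u w ≡ true × κ u w ≡ k

  -- The out-neighbours of the head of `u` in class `k`, if there is one. The decision is an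
  -- argument so that later facts can split on it.
  beyond : ∀ {k u} → Dec (∃ (Head k u)) → List V
  beyond (yes (w , _)) = outs w
  beyond (no  _)       = []

  head? : ∀ k u → Dec (∃ (Head k u))
  head? k u = any? (λ w → (out u w Bool.≟ true) ×-dec (κ u w ≟ k))

  -- The lower-ranked tails whose arcs in class `k` might conflict with the arc leaving `u`: at most
  -- `d` through `u` and `d` through its head.
  nbr : Class → V → List V
  nbr k u = outs u ++ beyond (head? k u)

  beyond-descending : ∀ {k u x} (h : Dec (∃ (Head k u))) → x ∈ beyond h → rank x < rank u
  beyond-descending (yes (w , uw , _)) x∈ = <-trans (descending (∈-outs⁻ x∈)) (descending uw)

  nbr-descending : ∀ k u {x} → x ∈ nbr k u → rank x < rank u
  nbr-descending k u x∈ with ∈-++⁻ (outs u) x∈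
  ... | inj₁ x∈₁ = descending (∈-outs⁻ x∈₁)
  ... | inj₂ x∈₂ = beyond-descending (head? k u) x∈₂

  length-beyond : ∀ {k u} (h : Dec (∃ (Head k u))) → length (beyond h) ≤ d
  length-beyond (yes (w , _)) = length-outs w
  length-beyond (no _)        = z≤n

  length-nbr : ∀ k u → length (nbr k u) < suc (d + d)
  length-nbr k u = s≤s (≤-trans (≤-reflexive (length-++ (outs u))) (+-mono-≤ (length-outs u) (length-beyond (head? k u))))

  tails : ∀ k → ∃[ t ] ((u : V) → rank u < size → ∀ {x} → x ∈ nbr k u → t x ≢ t u)
  tails k = Greedy.greedy (nbr k) rank (nbr-descending k) (length-nbr k) size

  tail : Class → V → Fin (suc (d + d))
  tail k = proj₁ (tails k)

  tail-proper : ∀ k u {x} → x ∈ nbr k u → tail k x ≢ tail k u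
  tail-proper k u = proj₂ (tails k) u (bounded u)

  -- The head found by the search must be `w`, because heads within a class are unique.
  out-of-head : ∀ {k u w x} → out u w ≡ true → κ u w ≡ k → out w x ≡ true → x ∈ nbr k u
  out-of-head {k} {u} {w} {x} uw κ≡ wx = ∈-++⁺ʳ (outs u) (member (head? k u))
    where
    member : (h : Dec (∃ (Head k u))) → x ∈ beyond h
    member (yes (w′ , uw′ , κ′≡)) with κ-separates {u} {w} {u} {w′} (trans κ≡ (sym κ′≡)) uw uw′
    ... | refl = ∈-outs⁺ wx
    member (no none) = contradiction (w , uw , κ≡) none

  enc : V → V → Fin (suc M * c * χ * suc (d + d))
  enc u w = combine (κ u w) (tail (κ u w) u)

  -- Two arcs of equal colour share their class and their tail colour, so neither tail is in the
  -- `nbr` list of the other. The facts below treat each kind of joining edge.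
  module Conflict {u w x y : V} (uw : out u w ≡ true) (xy : out x y ≡ true) (same : enc u w ≡ enc x y) where

    κ≡ : κ u w ≡ κ x y
    κ≡ = proj₁ (combine-injective {m = suc M * c * χ} _ _ _ _ same)

    tail≡ : tail (κ u w) u ≡ tail (κ u w) x
    tail≡ = trans (proj₂ (combine-injective {m = suc M * c * χ} _ _ _ _ same)) (cong (λ k → tail k x) (sym κ≡))

    x∉ : ¬ x ∈ nbr (κ u w) u
    x∉ x∈ = tail-proper (κ u w) u x∈ (sym tail≡)

    u∉ : ¬ u ∈ nbr (κ u w) x
    u∉ u∈ = tail-proper (κ u w) x u∈ tail≡

    tail-tail : adj G u x ≢ true
    tail-tail ux with oriented ux
    ... | inj₁ u→x = x∉ (∈-++⁺ˡ (∈-outs⁺ u→x))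
    ... | inj₂ x→u = u∉ (∈-++⁺ˡ (∈-outs⁺ x→u))

    head-head : adj G w y ≢ true
    head-head = κ-heads κ≡

    -- Directed from `u`, the edge makes `y` an out-neighbour of `u` with the layer and label of
    -- `w`. Directed from `y`, it makes `u` an out-neighbour of the head of `x`, which the tail
    -- colours exclude.
    tail-head : adj G u y ≡ true → w ≡ y
    tail-head adj-uy with oriented adj-uy
    ... | inj₁ u→y = κ-separates κ≡ uw u→y
    ... | inj₂ y→u = contradiction (out-of-head xy (sym κ≡) y→u) u∉

    head-tail : adj G w x ≡ true → y ≡ w
    head-tail adj-wx with oriented adj-wx
    ... | inj₁ w→x = contradiction (out-of-head uw refl w→x) x∉
    ... | inj₂ x→w = κ-separates (sym κ≡) xy x→w

  colour : V → V → Fin (suc M * c * χ * suc (d + d))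
  colour u w = if out u w then enc u w else enc w u

  colour-forward : ∀ {u w} → out u w ≡ true → colour u w ≡ enc u w
  colour-forward {u} {w} uw = cong (if_then enc u w else enc w u) uw

  -- Ranks descend along arcs, so the opposite arc is absent and the second branch is taken.
  colour-backward : ∀ {u w} → out u w ≡ true → colour w u ≡ enc u w
  colour-backward {u} {w} uw = cong (if_then enc w u else enc u w)
    (Bool.¬-not (λ wu → <-asym (descending uw) (descending wu)))

  symmetric : ∀ u v → E G u v → colour u v ≡ colour v u
  symmetric u v uv with oriented (T⇒≡ uv)
  ... | inj₁ u→v = trans (colour-forward u→v) (sym (colour-backward u→v))
  ... | inj₂ v→u = trans (colour-backward v→u) (sym (colour-forward v→u))

  injective : ∀ u v x y → E G u v → E G x y → colour u v ≡ colour x y → ¬ SameEdge u v x y →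
              E G v x → SameEdge v x u v ⊎ SameEdge v x x y
  -- The two orientations decide whether `v` and `x` are heads or tails. Equal kinds are impossible;
  -- a head joined to a tail forces the joining edge to be one of the two given edges.
  injective u v x y uv xy eq _ vx with oriented (T⇒≡ uv) | oriented (T⇒≡ xy)
  ... | inj₁ u→v | inj₁ x→y = inj₂ (inj₂ (sym (Conflict.head-tail u→v x→y
          (trans (sym (colour-forward u→v)) (trans eq (colour-forward x→y))) (T⇒≡ vx)) , refl))
  ... | inj₁ u→v | inj₂ y→x = contradiction (T⇒≡ vx) (Conflict.head-head u→v y→x
          (trans (sym (colour-forward u→v)) (trans eq (colour-backward y→x))))
  ... | inj₂ v→u | inj₁ x→y = contradiction (T⇒≡ vx) (Conflict.tail-tail v→u x→y
          (trans (sym (colour-backward v→u)) (trans eq (colour-forward x→y))))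
  ... | inj₂ v→u | inj₂ y→x = inj₁ (inj₂ (refl , sym (Conflict.tail-head v→u y→x
          (trans (sym (colour-backward v→u)) (trans eq (colour-backward y→x))) (T⇒≡ vx))))

  injEdgeColorable : InjEdgeColorable G (suc M * c * χ * suc (d + d))
  injEdgeColorable = colour , symmetric , injective

-- The exponential series

fromℚᵘ-* : ∀ p q → fromℚᵘ (p ℚᵘ.* q) ≡ fromℚᵘ p ℚ.* fromℚᵘ q
fromℚᵘ-* p q = ℚ.toℚᵘ-injective (begin-equality
  toℚᵘ (fromℚᵘ (p ℚᵘ.* q))             ≃⟨ ℚ.toℚᵘ-fromℚᵘ (p ℚᵘ.* q) ⟩
  p ℚᵘ.* q                             ≃⟨ ℚᵘ.*-cong (ℚ.toℚᵘ-fromℚᵘ p) (ℚ.toℚᵘ-fromℚᵘ q) ⟨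
  toℚᵘ (fromℚᵘ p) ℚᵘ.* toℚᵘ (fromℚᵘ q) ≃⟨ ℚ.toℚᵘ-homo-* (fromℚᵘ p) (fromℚᵘ q) ⟨
  toℚᵘ (fromℚᵘ p ℚ.* fromℚᵘ q)         ∎)
  where open ℚᵘ.≤-Reasoning

fromℚᵘ-+ : ∀ p q → fromℚᵘ (p ℚᵘ.+ q) ≡ fromℚᵘ p ℚ.+ fromℚᵘ q
fromℚᵘ-+ p q = ℚ.toℚᵘ-injective (begin-equality
  toℚᵘ (fromℚᵘ (p ℚᵘ.+ q))             ≃⟨ ℚ.toℚᵘ-fromℚᵘ (p ℚᵘ.+ q) ⟩
  p ℚᵘ.+ q                             ≃⟨ ℚᵘ.+-cong (ℚ.toℚᵘ-fromℚᵘ p) (ℚ.toℚᵘ-fromℚᵘ q) ⟨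
  toℚᵘ (fromℚᵘ p) ℚᵘ.+ toℚᵘ (fromℚᵘ q) ≃⟨ ℚ.toℚᵘ-homo-+ (fromℚᵘ p) (fromℚᵘ q) ⟨
  toℚᵘ (fromℚᵘ p ℚ.+ fromℚᵘ q)         ∎)
  where open ℚᵘ.≤-Reasoning

fromℕ-* : ∀ m n → fromℕ (m * n) ≡ fromℕ m ℚ.* fromℕ n
fromℕ-* m n = trans
  (ℚ.fromℚᵘ-cong {mkℚᵘ (ℤ.+ (m * n)) 0} {mkℚᵘ (ℤ.+ m) 0 ℚᵘ.* mkℚᵘ (ℤ.+ n) 0} (*≡* (cong (ℤ._* (ℤ.+ 1)) (ℤ.pos-* m n))))
  (fromℚᵘ-* (mkℚᵘ (ℤ.+ m) 0) (mkℚᵘ (ℤ.+ n) 0))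

fromℕ-suc : ∀ m → fromℕ (suc m) ≡ 1ℚ ℚ.+ fromℕ m
fromℕ-suc m = trans
  (ℚ.fromℚᵘ-cong {mkℚᵘ (ℤ.+ suc m) 0} {mkℚᵘ (ℤ.+ 1) 0 ℚᵘ.+ mkℚᵘ (ℤ.+ m) 0}
    (*≡* (cong (ℤ._* (ℤ.+ 1)) (cong (λ x → ℤ.+ 1 ℤ.+ x) (sym (ℤ.*-identityʳ (ℤ.+ m)))))))
  (fromℚᵘ-+ (mkℚᵘ (ℤ.+ 1) 0) (mkℚᵘ (ℤ.+ m) 0))

fromℕ-mono : ∀ {m n} → m ≤ n → fromℕ m ℚ.≤ fromℕ n
fromℕ-mono {m} {n} m≤n = ℚ.toℚᵘ-cancel-≤ (begin
  toℚᵘ (fromℕ m) ≃⟨ ℚ.toℚᵘ-fromℚᵘ (mkℚᵘ (ℤ.+ m) 0) ⟩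
  mkℚᵘ (ℤ.+ m) 0   ≤⟨ *≤* (ℤ.*-monoʳ-≤-nonNeg (ℤ.+ 1) (ℤ.+≤+ m≤n)) ⟩
  mkℚᵘ (ℤ.+ n) 0   ≃⟨ ℚ.toℚᵘ-fromℚᵘ (mkℚᵘ (ℤ.+ n) 0) ⟨
  toℚᵘ (fromℕ n) ∎)
  where open ℚᵘ.≤-Reasoning

fromℕ-cancel : ∀ {m n} → fromℕ m ℚ.≤ fromℕ n → m ≤ n
fromℕ-cancel {m} {n} m≤n = ℤ.drop‿+≤+ (ℤ.*-cancelʳ-≤-pos (ℤ.+ m) (ℤ.+ n) (ℤ.+ 1) (ℚᵘ.drop-*≤* (begin
  mkℚᵘ (ℤ.+ m) 0   ≃⟨ ℚ.toℚᵘ-fromℚᵘ (mkℚᵘ (ℤ.+ m) 0) ⟨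
  toℚᵘ (fromℕ m) ≤⟨ ℚ.toℚᵘ-mono-≤ m≤n ⟩
  toℚᵘ (fromℕ n) ≃⟨ ℚ.toℚᵘ-fromℚᵘ (mkℚᵘ (ℤ.+ n) 0) ⟩
  mkℚᵘ (ℤ.+ n) 0   ∎)))
  where open ℚᵘ.≤-Reasoning

fromℕ-nonNeg : ∀ m → NonNegative (fromℕ m)
fromℕ-nonNeg m = ℚ.normalize-nonNeg m 1

fromℕ-pos : ∀ m .{{_ : NonZero m}} → Positive (fromℕ m)
fromℕ-pos m = ℚ.normalize-pos m 1

recip : ℕ → ℚ
recip k = ℤ.+ 1 ℚ./ suc k

recip-nonNeg : ∀ k → NonNegative (recip k)
recip-nonNeg k = ℚ.normalize-nonNeg 1 (suc k)

recip-inverse : ∀ k → fromℕ (suc k) ℚ.* recip k ≡ 1ℚ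
recip-inverse k = trans (sym (fromℚᵘ-* (mkℚᵘ (ℤ.+ suc k) 0) (mkℚᵘ (ℤ.+ 1) k)))
  (ℚ.fromℚᵘ-cong {mkℚᵘ (ℤ.+ suc k) 0 ℚᵘ.* mkℚᵘ (ℤ.+ 1) k} {mkℚᵘ (ℤ.+ 1) 0}
    (*≡* (cong ℤ.+_ (trans (*-identityʳ (suc k * 1)) (trans (*-identityʳ (suc k))
      (sym (trans (*-identityˡ (1 * suc k)) (*-identityˡ (suc k)))))))))

product-nonNeg : ∀ m k → NonNegative (fromℕ m ℚ.* recip k)
product-nonNeg m k = ℚ.nonNeg*nonNeg⇒nonNeg (fromℕ m) {{fromℕ-nonNeg m}} (recip k) {{recip-nonNeg k}}

module _ (b δ : ℚ) .{{b≥0 : NonNegative b}} .{{δ≥0 : NonNegative δ}} where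

  private
    x = b ℚ.+ δ

    instance
      x≥0 : NonNegative (b ℚ.+ δ)
      x≥0 = ℚ.nonNeg+nonNeg⇒nonNeg b δ

    term≥0 : ∀ k → NonNegative (expTerm x k)
    term≥0 zero    = _
    term≥0 (suc k) = ℚ.nonNeg*nonNeg⇒nonNeg (expTerm x k ℚ.* x)
      {{ℚ.nonNeg*nonNeg⇒nonNeg (expTerm x k) {{term≥0 k}} x}} (recip k) {{recip-nonNeg k}}

  open ℚ.≤-Reasoning
  open ℚ-Solver using (solve; _:+_; _:*_; _:=_; con)

  -- The tangent line inequality xᵏ⁺¹ ≤ bᵏ⁺¹ + (k + 1) δ xᵏ for x = b + δ, divided by (k + 1)!.
  expTerm-tangent : ∀ k → expTerm x (suc k) ℚ.≤ expTerm b (suc k) ℚ.+ δ ℚ.* expTerm x k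
  expTerm-tangent zero = ℚ.≤-reflexive
    (solve 2 (λ b δ → con 1ℚ :* (b :+ δ) :* con 1ℚ := con 1ℚ :* b :* con 1ℚ :+ δ :* con 1ℚ) refl b δ)
  expTerm-tangent (suc k) = begin
    X₁ ℚ.* x ℚ.* r
      ≡⟨ solve 4 (λ X₁ b δ r → X₁ :* (b :+ δ) :* r := r :* (b :* X₁ :+ δ :* X₁)) refl X₁ b δ r ⟩
    r ℚ.* (b ℚ.* X₁ ℚ.+ δ ℚ.* X₁)
      ≤⟨ ℚ.*-monoˡ-≤-nonNeg r {{recip-nonNeg (suc k)}} (ℚ.+-monoˡ-≤ (δ ℚ.* X₁) (ℚ.*-monoˡ-≤-nonNeg b (expTerm-tangent k))) ⟩
    r ℚ.* (b ℚ.* (B₁ ℚ.+ δ ℚ.* X₀) ℚ.+ δ ℚ.* X₁)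
      ≡⟨ solve 6 (λ r b B₁ δ X₀ X₁ → r :* (b :* (B₁ :+ δ :* X₀) :+ δ :* X₁) := B₁ :* b :* r :+ r :* (δ :* (X₀ :* b :+ X₁)))
           refl r b B₁ δ X₀ X₁ ⟩
    B₁ ℚ.* b ℚ.* r ℚ.+ r ℚ.* (δ ℚ.* (X₀ ℚ.* b ℚ.+ X₁))
      ≤⟨ ℚ.+-monoʳ-≤ (B₁ ℚ.* b ℚ.* r) (ℚ.*-monoˡ-≤-nonNeg r {{recip-nonNeg (suc k)}} (ℚ.*-monoˡ-≤-nonNeg δ
           (ℚ.+-monoˡ-≤ X₁ (ℚ.*-monoˡ-≤-nonNeg X₀ {{term≥0 k}} b≤x)))) ⟩
    B₁ ℚ.* b ℚ.* r ℚ.+ r ℚ.* (δ ℚ.* (X₀ ℚ.* x ℚ.+ X₁))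
      ≡⟨ cong (λ y → B₁ ℚ.* b ℚ.* r ℚ.+ r ℚ.* (δ ℚ.* (y ℚ.+ X₁))) X₀x ⟩
    B₁ ℚ.* b ℚ.* r ℚ.+ r ℚ.* (δ ℚ.* (fromℕ (suc k) ℚ.* X₁ ℚ.+ X₁))
      ≡⟨ solve 5 (λ a r δ s X₁ → a :+ r :* (δ :* (s :* X₁ :+ X₁)) := a :+ (con 1ℚ :+ s) :* r :* (δ :* X₁))
           refl (B₁ ℚ.* b ℚ.* r) r δ (fromℕ (suc k)) X₁ ⟩
    B₁ ℚ.* b ℚ.* r ℚ.+ (1ℚ ℚ.+ fromℕ (suc k)) ℚ.* r ℚ.* (δ ℚ.* X₁)
      ≡⟨ cong (λ y → B₁ ℚ.* b ℚ.* r ℚ.+ y ℚ.* (δ ℚ.* X₁))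
           (trans (cong (ℚ._* r) (sym (fromℕ-suc (suc k)))) (recip-inverse (suc k))) ⟩
    B₁ ℚ.* b ℚ.* r ℚ.+ 1ℚ ℚ.* (δ ℚ.* X₁)
      ≡⟨ cong (B₁ ℚ.* b ℚ.* r ℚ.+_) (ℚ.*-identityˡ (δ ℚ.* X₁)) ⟩
    B₁ ℚ.* b ℚ.* r ℚ.+ δ ℚ.* X₁ ∎
    where
    X₀ = expTerm x k
    X₁ = expTerm x (suc k)
    B₁ = expTerm b (suc k)
    r = recip (suc k)
    b≤x : b ℚ.≤ x
    b≤x = subst (ℚ._≤ x) (ℚ.+-identityʳ b) (ℚ.+-monoʳ-≤ b (ℚ.nonNegative⁻¹ δ))
    X₀x : X₀ ℚ.* x ≡ fromℕ (suc k) ℚ.* X₁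
    X₀x = sym (trans
      (solve 3 (λ s y r → s :* (y :* r) := s :* r :* y) refl (fromℕ (suc k)) (X₀ ℚ.* x) (recip k))
      (trans (cong (ℚ._* (X₀ ℚ.* x)) (recip-inverse k)) (ℚ.*-identityˡ (X₀ ℚ.* x))))

  -- Summation of the tangent inequalities. The constant term has no increment, hence only `m` terms
  -- next to `δ`.
  expPartial-tangent : ∀ m → expPartial x (suc m) ℚ.≤ expPartial b (suc m) ℚ.+ δ ℚ.* expPartial x m
  expPartial-tangent zero = ℚ.≤-reflexive
    (solve 1 (λ δ → con 0ℚ :+ con 1ℚ := con 0ℚ :+ con 1ℚ :+ δ :* con 0ℚ) refl δ)
  expPartial-tangent (suc m) = begin
    expPartial x (suc m) ℚ.+ expTerm x (suc m)
      ≤⟨ ℚ.+-mono-≤ (expPartial-tangent m) (expTerm-tangent m) ⟩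
    (expPartial b (suc m) ℚ.+ δ ℚ.* expPartial x m) ℚ.+ (expTerm b (suc m) ℚ.+ δ ℚ.* expTerm x m)
      ≡⟨ solve 5 (λ a δ p t q → (a :+ δ :* p) :+ (t :+ δ :* q) := (a :+ t) :+ δ :* (p :+ q)) refl
           (expPartial b (suc m)) δ (expPartial x m) (expTerm b (suc m)) (expTerm x m) ⟩
    expPartial b (suc (suc m)) ℚ.+ δ ℚ.* expPartial x (suc m) ∎

  -- With the same truncation everywhere, the inequality can be solved for the value at `x`: it
  -- bounds (1 - δ) times that value.
  expPartial-step : ∀ m → expPartial x m ℚ.≤ expPartial b m ℚ.+ δ ℚ.* expPartial x m
  expPartial-step zero = ℚ.≤-reflexive (solve 1 (λ δ → con 0ℚ := con 0ℚ :+ δ :* con 0ℚ) refl δ)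
  expPartial-step (suc m) = begin
    expPartial x (suc m)                               ≤⟨ expPartial-tangent m ⟩
    expPartial b (suc m) ℚ.+ δ ℚ.* expPartial x m      ≤⟨ ℚ.+-monoʳ-≤ (expPartial b (suc m)) (ℚ.*-monoˡ-≤-nonNeg δ grow) ⟩
    expPartial b (suc m) ℚ.+ δ ℚ.* expPartial x (suc m) ∎
    where
    grow : expPartial x m ℚ.≤ expPartial x (suc m)
    grow = subst (ℚ._≤ expPartial x (suc m)) (ℚ.+-identityʳ (expPartial x m))
      (ℚ.+-monoʳ-≤ (expPartial x m) (ℚ.nonNegative⁻¹ (expTerm x m) {{term≥0 m}}))

expPartial-0 : ∀ m → expPartial 0ℚ m ℚ.≤ 1ℚ
expPartial-0 zero          = ℚ.nonNegative⁻¹ 1ℚ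
expPartial-0 (suc zero)    = ℚ.≤-refl
expPartial-0 (suc (suc m)) = ℚ.≤-trans (ℚ.≤-reflexive (trans (cong (expPartial 0ℚ (suc m) ℚ.+_) vanish) (ℚ.+-identityʳ _)))
  (expPartial-0 (suc m))
  where
  vanish : expTerm 0ℚ (suc m) ≡ 0ℚ
  vanish = trans (cong (ℚ._* recip m) (ℚ.*-zeroʳ (expTerm 0ℚ m))) (ℚ.*-zeroˡ (recip m))

-- exp (K / (q + 1)) ≤ ((q + 1) / q) ^ K, by K tangent steps of length 1 / (q + 1).
expPartial-bound : ∀ q m K → fromℕ (q ^ K) ℚ.* expPartial (fromℕ K ℚ.* recip q) m ℚ.≤ fromℕ (suc q ^ K)
expPartial-bound q m zero = subst (λ y → 1ℚ ℚ.* expPartial y m ℚ.≤ 1ℚ) (sym (ℚ.*-zeroˡ (recip q)))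
  (ℚ.≤-trans (ℚ.≤-reflexive (ℚ.*-identityˡ (expPartial 0ℚ m))) (expPartial-0 m))
expPartial-bound q m (suc K) = subst (λ y → fromℕ (q ^ suc K) ℚ.* expPartial y m ℚ.≤ fromℕ (suc q ^ suc K)) (sym split) (begin
  fromℕ (q ^ suc K) ℚ.* X                ≡⟨ cong (ℚ._* X) (fromℕ-* q (q ^ K)) ⟩
  fromℕ q ℚ.* P ℚ.* X                    ≡⟨ solve 3 (λ q p x → q :* p :* x := p :* (q :* x)) refl (fromℕ q) P X ⟩
  P ℚ.* (fromℕ q ℚ.* X)                  ≤⟨ ℚ.*-monoˡ-≤-nonNeg P {{fromℕ-nonNeg (q ^ K)}} shrink ⟩
  P ℚ.* (fromℕ (suc q) ℚ.* B)            ≡⟨ solve 3 (λ p q b → p :* (q :* b) := q :* (p :* b)) refl P (fromℕ (suc q)) B ⟩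
  fromℕ (suc q) ℚ.* (P ℚ.* B)            ≤⟨ ℚ.*-monoˡ-≤-nonNeg (fromℕ (suc q)) {{fromℕ-nonNeg (suc q)}} (expPartial-bound q m K) ⟩
  fromℕ (suc q) ℚ.* fromℕ (suc q ^ K)    ≡⟨ fromℕ-* (suc q) (suc q ^ K) ⟨
  fromℕ (suc q ^ suc K)                  ∎)
  where
  open ℚ.≤-Reasoning
  open ℚ-Solver using (solve; _:+_; _:*_; _:=_; _:-_; con)
  b = fromℕ K ℚ.* recip q
  X = expPartial (b ℚ.+ recip q) m
  B = expPartial b m
  P = fromℕ (q ^ K)
  split : fromℕ (suc K) ℚ.* recip q ≡ b ℚ.+ recip q
  split = trans (cong (ℚ._* recip q) (fromℕ-suc K))
    (solve 2 (λ k r → (con 1ℚ :+ k) :* r := k :* r :+ r) refl (fromℕ K) (recip q))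
  step : X ℚ.≤ B ℚ.+ recip q ℚ.* X
  step = expPartial-step b (recip q) {{product-nonNeg K q}} {{recip-nonNeg q}} m
  -- This is `step` multiplied by q + 1, after which one copy of `X` is moved to the left.
  shrink : fromℕ q ℚ.* X ℚ.≤ fromℕ (suc q) ℚ.* B
  shrink = begin
    fromℕ q ℚ.* X
      ≡⟨ solve 2 (λ q x → q :* x := (con 1ℚ :+ q) :* x :- x) refl (fromℕ q) X ⟩
    (1ℚ ℚ.+ fromℕ q) ℚ.* X ℚ.- X
      ≡⟨ cong (λ y → y ℚ.* X ℚ.- X) (fromℕ-suc q) ⟨
    fromℕ (suc q) ℚ.* X ℚ.- X
      ≤⟨ ℚ.+-monoˡ-≤ (ℚ.- X) (ℚ.*-monoˡ-≤-nonNeg (fromℕ (suc q)) {{fromℕ-nonNeg (suc q)}} step) ⟩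
    fromℕ (suc q) ℚ.* (B ℚ.+ recip q ℚ.* X) ℚ.- X
      ≡⟨ solve 4 (λ s b r x → s :* (b :+ r :* x) :- x := s :* b :+ (s :* r :* x :- x)) refl (fromℕ (suc q)) B (recip q) X ⟩
    fromℕ (suc q) ℚ.* B ℚ.+ (fromℕ (suc q) ℚ.* recip q ℚ.* X ℚ.- X)
      ≡⟨ cong (λ y → fromℕ (suc q) ℚ.* B ℚ.+ (y ℚ.* X ℚ.- X)) (recip-inverse q) ⟩
    fromℕ (suc q) ℚ.* B ℚ.+ (1ℚ ℚ.* X ℚ.- X)
      ≡⟨ solve 2 (λ a x → a :+ (con 1ℚ :* x :- x) := a) refl (fromℕ (suc q) ℚ.* B) X ⟩
    fromℕ (suc q) ℚ.* B ∎

-- Uses e > 1957 / 720.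
log-bound : ∀ {d Δ N} q K .{{_ : NonZero q}} → FourEdLogLe d Δ N → suc q ^ K ≤ Δ * q ^ K →
            4 * d * 1957 * K ≤ N * (720 * suc q)
log-bound {d} {Δ} {N} q K le pow = fromℕ-cancel {4 * d * 1957 * K} {N * (720 * suc q)} (begin
  fromℕ (4 * d * 1957 * K)
    ≡⟨ trans (fromℕ-* (4 * d * 1957) K) (cong (ℚ._* fromℕ K) (fromℕ-* (4 * d) 1957)) ⟩
  fromℕ (4 * d) ℚ.* fromℕ 1957 ℚ.* fromℕ K
    -- The seven terms of `e₇` add up to 1957 / 720, so `fromℕ 1957` and `e₇ ℚ.* fromℕ 720` agree by
    -- evaluation.
    ≡⟨ solve 3 (λ D e k → D :* e :* k := D :* e :* k :* con 1ℚ) refl (fromℕ (4 * d)) (fromℕ 1957) (fromℕ K) ⟩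
  fromℕ (4 * d) ℚ.* (e₇ ℚ.* fromℕ 720) ℚ.* fromℕ K ℚ.* 1ℚ
    ≡⟨ cong (fromℕ (4 * d) ℚ.* (e₇ ℚ.* fromℕ 720) ℚ.* fromℕ K ℚ.*_) (recip-inverse q) ⟨
  fromℕ (4 * d) ℚ.* (e₇ ℚ.* fromℕ 720) ℚ.* fromℕ K ℚ.* (fromℕ (suc q) ℚ.* recip q)
    ≡⟨ solve 6 (λ D e s k q r → D :* (e :* s) :* k :* (q :* r) := D :* e :* (k :* r) :* (s :* q)) refl
         (fromℕ (4 * d)) e₇ (fromℕ 720) (fromℕ K) (fromℕ (suc q)) (recip q) ⟩
  fromℕ (4 * d) ℚ.* e₇ ℚ.* b ℚ.* (fromℕ 720 ℚ.* fromℕ (suc q))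
    ≡⟨ cong (fromℕ (4 * d) ℚ.* e₇ ℚ.* b ℚ.*_) (fromℕ-* 720 (suc q)) ⟨
  fromℕ (4 * d) ℚ.* e₇ ℚ.* b ℚ.* fromℕ (720 * suc q)
    ≤⟨ ℚ.*-monoʳ-≤-nonNeg (fromℕ (720 * suc q)) {{fromℕ-nonNeg (720 * suc q)}} (le 7 b (ℚ.nonNegative⁻¹ b {{product-nonNeg K q}}) exp≤Δ) ⟩
  fromℕ N ℚ.* fromℕ (720 * suc q)
    ≡⟨ fromℕ-* N (720 * suc q) ⟨
  fromℕ (N * (720 * suc q)) ∎)
  where
  open ℚ.≤-Reasoning
  open ℚ-Solver using (solve; _:*_; _:=_; con)
  e₇ = expPartial 1ℚ 7
  b = fromℕ K ℚ.* recip q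
  -- The number b = K / (q + 1) is an admissible lower bound for log Δ, since exp b ≤ ((q + 1) /
  -- q)^K ≤ Δ.
  exp≤Δ : ∀ j → expPartial b j ℚ.≤ fromℕ Δ
  exp≤Δ j = ℚ.*-cancelˡ-≤-pos (fromℕ (q ^ K)) {{fromℕ-pos (q ^ K) {{m^n≢0 q K}}}} (begin
    fromℕ (q ^ K) ℚ.* expPartial b j ≤⟨ expPartial-bound q j K ⟩
    fromℕ (suc q ^ K)                ≤⟨ fromℕ-mono pow ⟩
    fromℕ (Δ * q ^ K)                ≡⟨ cong fromℕ (*-comm Δ (q ^ K)) ⟩
    fromℕ (q ^ K * Δ)                ≡⟨ fromℕ-* (q ^ K) Δ ⟩
    fromℕ (q ^ K) ℚ.* fromℕ Δ        ∎)

-- The numerical choice of the number of layers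

open +-*-Solver using (solve; _:+_; _:*_; _:=_; con)

binary-log : ∀ n → ∃[ t ] 2 ^ t ≤ suc n × suc n < 2 ^ suc t
binary-log zero    = 0 , s≤s z≤n , s≤s (s≤s z≤n)
binary-log (suc n) with binary-log n
... | t , lower , upper with m≤n⇒m<n∨m≡n upper
...   | inj₁ small = t , m≤n⇒m≤1+n lower , small
...   | inj₂ exact = suc t , ≤-reflexive (sym exact) ,
  subst (_< 2 ^ suc (suc t)) (sym exact) (^-monoʳ-< 2 (s≤s (s≤s z≤n)) (n<1+n (suc t)))

^-distribʳ-* : ∀ k m n → (m * n) ^ k ≡ m ^ k * n ^ k
^-distribʳ-* zero    m n = refl
^-distribʳ-* (suc k) m n = trans (cong (m * n *_) (^-distribʳ-* k m n)) ([m*n]*[o*p]≡[m*o]*[n*p] m n (m ^ k) (n ^ k))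

^-double : ∀ a b k t → a ^ k ≤ 2 * b ^ k → a ^ (k * t) ≤ 2 ^ t * b ^ (k * t)
^-double a b k t le = begin
  a ^ (k * t)         ≡⟨ ^-*-assoc a k t ⟨
  (a ^ k) ^ t         ≤⟨ ^-monoˡ-≤ t le ⟩
  (2 * b ^ k) ^ t     ≡⟨ ^-distribʳ-* t 2 (b ^ k) ⟩
  2 ^ t * (b ^ k) ^ t ≡⟨ cong (2 ^ t *_) (^-*-assoc b k t) ⟩
  2 ^ t * b ^ (k * t) ∎
  where open ≤-Reasoning

-- Here t = 3 + s. At t = 2 the inequality fails, as 256 > 243.
16·4^t≤3·9^t : ∀ s → 4 * (2 ^ (4 + s) * 2 ^ (4 + s)) ≤ 3 * 9 ^ (3 + s)
16·4^t≤3·9^t zero    = ≤ᵇ⇒≤ 1024 2187 _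
16·4^t≤3·9^t (suc s) = begin
  4 * (2 * x * (2 * x)) ≡⟨ solve 1 (λ x → con 4 :* (con 2 :* x :* (con 2 :* x)) := con 4 :* (con 4 :* (x :* x))) refl x ⟩
  4 * (4 * (x * x))     ≤⟨ *-mono-≤ (≤ᵇ⇒≤ 4 9 _) (16·4^t≤3·9^t s) ⟩
  9 * (3 * y)           ≡⟨ solve 1 (λ y → con 9 :* (con 3 :* y) := con 3 :* (con 9 :* y)) refl y ⟩
  3 * (9 * y)           ∎
  where
  open ≤-Reasoning
  x = 2 ^ (4 + s)
  y = 9 ^ (3 + s)

4Δ²≤3^ : ∀ {Δ} s → Δ < 2 ^ (3 + s) → 4 * (Δ * Δ) ≤ 3 ^ suc (2 * (2 + s))
4Δ²≤3^ {Δ} s Δ< = ≤-trans (bound s Δ<) (≤-reflexive (cong (3 *_) (^-*-assoc 3 2 (2 + s))))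
  where
  bound : ∀ s → Δ < 2 ^ (3 + s) → 4 * (Δ * Δ) ≤ 3 * 9 ^ (2 + s)
  -- For t = 2 integrality rescues the bound: Δ ≤ 7 gives 4 · 49 = 196 ≤ 243.
  bound zero    Δ<8 = ≤-trans (*-monoʳ-≤ 4 (*-mono-≤ (≤-pred Δ<8) (≤-pred Δ<8))) (≤ᵇ⇒≤ 196 243 _)
  bound (suc s) Δ<  = ≤-trans (*-monoʳ-≤ 4 (*-mono-≤ (<⇒≤ Δ<) (<⇒≤ Δ<))) (16·4^t≤3·9^t s)

-- With 3 (e + 1) labels a layer collides with probability below 1/3, and the neighbourhood bound (e
-- + 1) Δ is at most Δ².
few-collisions : ∀ {e Δ} M → suc e ≤ Δ → 4 * (Δ * Δ) ≤ 3 ^ M → 4 * (suc e * Δ) * e ^ M ≤ (3 * suc e) ^ M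
few-collisions {e} {Δ} M e<Δ le = begin
  4 * (suc e * Δ) * e ^ M ≤⟨ *-mono-≤ (*-monoʳ-≤ 4 (*-monoˡ-≤ Δ e<Δ)) (^-monoˡ-≤ M (n≤1+n e)) ⟩
  4 * (Δ * Δ) * suc e ^ M ≤⟨ *-monoˡ-≤ (suc e ^ M) le ⟩
  3 ^ M * suc e ^ M       ≡⟨ ^-distribʳ-* M 3 (suc e) ⟨
  (3 * suc e) ^ M         ∎
  where open ≤-Reasoning

-- With t the integer part of log₂ Δ, 2t + 1 layers serve for Δ ≥ 4, and three layers for Δ = 3. The
-- witness is one less than the number of layers.
layers : ∀ {d Δ N e} → 3 ≤ Δ → suc e ≤ d → suc e ≤ Δ → FourEdLogLe d Δ N →
         ∃[ M ] suc M * (3 * suc e) ≤ N × 4 * (suc e * Δ) * e ^ suc M ≤ (3 * suc e) ^ suc M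
layers {d} {Δ} {N} {e} 3≤Δ e<d e<Δ le with m≤n⇒m<n∨m≡n 3≤Δ
... | inj₂ refl = 2 , enough , rare e e<Δ
  where
  open ≤-Reasoning
  -- The factor 144000 = 720 · 200 clears the denominators of e > 1957 / 720 and log 3 ≥ 168 / 200.
  enough : 3 * (3 * suc e) ≤ N
  enough = *-cancelʳ-≤ (3 * (3 * suc e)) N 144000 (begin
    3 * (3 * suc e) * 144000 ≤⟨ *-monoˡ-≤ 144000 (*-monoʳ-≤ 3 (*-monoʳ-≤ 3 e<d)) ⟩
    3 * (3 * d) * 144000     ≡⟨ solve 1 (λ d → con 3 :* (con 3 :* d) :* con 144000 := d :* con 1296000) refl d ⟩
    d * 1296000              ≤⟨ *-monoʳ-≤ d (≤ᵇ⇒≤ 1296000 1315104 _) ⟩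
    d * 1315104              ≡⟨ solve 1 (λ d → d :* con 1315104 := con 4 :* d :* con 1957 :* con 168) refl d ⟩
    4 * d * 1957 * 168       ≤⟨ log-bound {d} {3} {N} 199 168 le (≤ᵇ⇒≤ (200 ^ 168) (3 * 199 ^ 168) _) ⟩
    N * 144000               ∎)
  -- The estimate through Δ² would need 36 ≤ 27, so the three possible values of `e` are checked
  -- directly.
  rare : ∀ e → suc e ≤ 3 → 4 * (suc e * 3) * e ^ 3 ≤ (3 * suc e) ^ 3
  rare 0 _ = z≤n
  rare 1 _ = ≤ᵇ⇒≤ 24 216 _
  rare 2 _ = ≤ᵇ⇒≤ 288 729 _
  rare (suc (suc (suc _))) (s≤s (s≤s (s≤s ())))
... | inj₁ 4≤Δ with binary-log (pred Δ)
...   | t₀ , lower₀ , upper₀ = choose t₀ (subst (2 ^ t₀ ≤_) Δ≡ lower₀) (subst (_< 2 ^ suc t₀) Δ≡ upper₀)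
  where
  open ≤-Reasoning
  Δ≡ : suc (pred Δ) ≡ Δ
  Δ≡ = suc-pred Δ {{>-nonZero (≤-trans (s≤s z≤n) 4≤Δ)}}
  choose : ∀ t → 2 ^ t ≤ Δ → Δ < 2 ^ suc t →
           ∃[ M ] suc M * (3 * suc e) ≤ N × 4 * (suc e * Δ) * e ^ suc M ≤ (3 * suc e) ^ suc M
  choose 0 _ upper = contradiction (≤-trans upper (≤ᵇ⇒≤ 2 4 _)) (≤⇒≯ 4≤Δ)
  choose 1 _ upper = contradiction upper (≤⇒≯ 4≤Δ)
  choose (suc (suc s)) lower upper = 2 * t , enough , few-collisions (suc (2 * t)) e<Δ (4Δ²≤3^ s upper)
    where
    t = 2 + s
    -- This encodes log Δ ≥ t log 2 with log 2 ≥ 138 / 200.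
    pow : 200 ^ (138 * t) ≤ Δ * 199 ^ (138 * t)
    pow = ≤-trans (^-double 200 199 138 t (≤ᵇ⇒≤ (200 ^ 138) (2 * 199 ^ 138) _)) (*-monoˡ-≤ (199 ^ (138 * t)) lower)
    -- Large numerals are kept abstract and to the right of _*_, which recurses on its left argument.
    expand : ∀ g → (1 + 2 * t) * (3 * d) * (2 * g) ≡ t * d * (12 * g) + 2 * d * (3 * g)
    expand = solve 3 (λ t d g → (con 1 :+ con 2 :* t) :* (con 3 :* d) :* (con 2 :* g)
      := t :* d :* (con 12 :* g) :+ con 2 :* d :* (con 3 :* g)) refl t d
    regroup : ∀ a b → t * d * (4 * a * b) ≡ 4 * d * a * (b * t)
    regroup = solve 4 (λ t d a b → t :* d :* (con 4 :* a :* b) := con 4 :* d :* a :* (b :* t)) refl t d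
    enough : suc (2 * t) * (3 * suc e) ≤ N
    enough = *-cancelʳ-≤ (suc (2 * t) * (3 * suc e)) N 144000 (begin
      (1 + 2 * t) * (3 * suc e) * 144000
        ≤⟨ *-monoˡ-≤ 144000 (*-monoʳ-≤ (1 + 2 * t) (*-monoʳ-≤ 3 e<d)) ⟩
      (1 + 2 * t) * (3 * d) * 144000
        ≡⟨ expand 72000 ⟩
      t * d * 864000 + 2 * d * 216000
        -- Since t ≥ 2, the contribution of the extra layer is absorbed into a multiple of t.
        ≤⟨ +-monoʳ-≤ (t * d * 864000) (*-monoˡ-≤ 216000 (*-monoˡ-≤ d (m≤m+n 2 s))) ⟩
      t * d * 864000 + t * d * 216000
        ≡⟨ *-distribˡ-+ (t * d) 864000 216000 ⟨
      t * d * 1080000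
        ≤⟨ *-monoʳ-≤ (t * d) (≤ᵇ⇒≤ 1080000 1080264 _) ⟩
      t * d * 1080264
        ≡⟨ regroup 1957 138 ⟩
      4 * d * 1957 * (138 * t)
        ≤⟨ log-bound {d} {Δ} {N} 199 (138 * t) le pow ⟩
      N * 144000 ∎)

theorem2p1 : (d Δ χ N k : ℕ) (G : Graph) →
    1 ≤ d → 3 ≤ Δ →
    Degenerate G d → MaxDegree G Δ → ChromaticNumber G χ →
    IsCeil4edLog d Δ N → InjChromaticIndex G k →
    k ≤ N * (2 * d + 1) * χ
theorem2p1 d Δ χ N k G 1≤d 3≤Δ degenerate (degree≤Δ , _) ((φ , proper) , _) (ceil , _) (_ , minimal) =
  conclude (layers 3≤Δ suc-e≤d suc-e≤Δ ceil)
  where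
  orientation = Peeling.orientation G d degenerate
  open Orientation orientation
  -- Capping the out-degree by Δ as well keeps the neighbourhood bound below Δ², even when d exceeds
  -- Δ.
  e = pred (d ⊓ Δ)
  suc-e≡ : suc e ≡ d ⊓ Δ
  suc-e≡ = suc-pred (d ⊓ Δ) {{>-nonZero (⊓-glb 1≤d (≤-trans (s≤s z≤n) 3≤Δ))}}
  suc-e≤d : suc e ≤ d
  suc-e≤d = subst (_≤ d) (sym suc-e≡) (m⊓n≤m d Δ)
  suc-e≤Δ : suc e ≤ Δ
  suc-e≤Δ = subst (_≤ Δ) (sym suc-e≡) (m⊓n≤n d Δ)
  outdegree′ : ∀ u → count (out u) ≤ suc e
  outdegree′ u = subst (count (out u) ≤_) (sym suc-e≡)
    (⊓-glb (outdegree u) (≤-trans (count-mono {b = out u} {adj G u} (λ _ → out⇒adj)) (degree≤Δ u)))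
  indegree : ∀ w → count (λ u → out u w) ≤ Δ
  indegree w = ≤-trans (count-mono {b = λ u → out u w} {adj G w} (λ u uw → trans (Graph.sym G w u) (out⇒adj uw))) (degree≤Δ w)
  conclude : (∃[ M ] suc M * (3 * suc e) ≤ N × 4 * (suc e * Δ) * e ^ suc M ≤ (3 * suc e) ^ suc M) →
             k ≤ N * (2 * d + 1) * χ
  conclude (M , enough , few) = begin
    k                                           ≤⟨ minimal _ colouring ⟩
    suc M * (3 * suc e) * χ * suc (d + d)       ≤⟨ *-monoˡ-≤ (suc (d + d)) (*-monoˡ-≤ χ enough) ⟩
    N * χ * suc (d + d)                         ≡⟨ solve 3 (λ N χ d → N :* χ :* (con 1 :+ (d :+ d)) := N :* (con 2 :* d :+ con 1) :* χ) refl N χ d ⟩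
    N * (2 * d + 1) * χ                         ∎
    where
    open ≤-Reasoning
    labelling = Labelling.separating-labels out e Δ (3 * suc e) (suc M)
      {{_}} {{>-nonZero (≤-trans (s≤s z≤n) 3≤Δ)}} outdegree′ indegree few
    colouring : InjEdgeColorable G (suc M * (3 * suc e) * χ * suc (d + d))
    colouring = Colouring.injEdgeColorable G orientation φ proper (proj₁ labelling) (proj₂ labelling)
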